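{- For every integer $n$ with $n \equiv 0$ or $2 \pmod 3$, $3 \leq n \leq 14$ and $n \neq 12$, there exists an $(n+1)$-regular, $(n+1)$-connected trigeodetic block of diameter $4$.
   Context: Graphs are undirected, without loops or multiple edges. The distance between two vertices is the length (number of edges) of a shortest path connecting them, and the diameter of a graph is the greatest distance between any pair of its vertices. A graph is $k$-regular if every vertex has degree $k$. A graph is trigeodetic if each pair of nonadjacent vertices has at most $3$ distinct paths of minimum length between them. The vertex connectivity of a graph is the minimum number of vertices whose deletion (together with all edges incident to them) disconnects the graph. A graph is called $p$-connected if its vertex connectivity is equal to $p$ (equality, not merely at least $p$). A block is a graph whose vertex connectivity is $p > 1$. -}

module Defs where

open import Data.Fin.Base using (Fin)
open import Data.Fin.Subset using (Subset; _∈_; ∁; ∣_∣)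
open import Data.List.Base using (List; allFin; filter; head; last; length)
open import Data.List.Relation.Unary.All using (All)
open import Data.List.Relation.Unary.Linked using (Linked)
open import Data.List.Relation.Unary.Unique.Propositional using (Unique)
open import Data.Maybe.Base using (just)
open import Data.Nat.Base using (ℕ; suc; _≤_; _<_)
open import Data.Product.Base using (∃; ∃-syntax; _×_; proj₁)
open import Function.Base using (_on_)
open import Level using (0ℓ)
open import Relation.Binary.Core using (Rel)
open import Relation.Binary.Definitions using (Decidable; Symmetric)
open import Relation.Binary.PropositionalEquality.Core using (_≡_; _≢_)
open import Relation.Nullary.Negation.Core using (¬_)

record Graph (V : Set) : Set₁ where
  field
    Adj        : Rel V 0ℓ
    adj?       : Decidable Adj
    adj-sym    : Symmetric Adj
    adj-irrefl : ∀ {v} → ¬ Adj v v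

module _ {V : Set} (G : Graph V) where
  open Graph G

  -- A path is given by the list of its vertices, so that equality of
  -- paths does not involve proofs of adjacency.
  record IsPath (u v : V) (vs : List V) : Set where
    constructor mkPath
    field
      starts   : head vs ≡ just u
      ends     : last vs ≡ just v
      linked   : Linked Adj vs
      distinct : Unique vs

  Connected : Set
  Connected = ∀ u v → ∃[ vs ] IsPath u v vs

  IsShortestPath : V → V → List V → Set
  IsShortestPath u v vs =
    IsPath u v vs × (∀ ws → IsPath u v ws → length vs ≤ length ws)

  -- A path with d edges has d + 1 vertices.
  HasDistance : V → V → ℕ → Set
  HasDistance u v d = ∃[ vs ] (IsShortestPath u v vs × length vs ≡ suc d)

  HasDiameter : ℕ → Set
  HasDiameter d =
    (∀ u v → ∃[ k ] (HasDistance u v k × k ≤ d)) ×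
    (∃[ u ] ∃[ v ] HasDistance u v d)

  -- "At most 3": every list of pairwise distinct shortest paths has
  -- length at most 3.
  Trigeodetic : Set
  Trigeodetic = ∀ u v → u ≢ v → ¬ Adj u v →
    ∀ (ps : List (List V)) → Unique ps → All (IsShortestPath u v) ps →
    length ps ≤ 3

module _ {N : ℕ} (G : Graph (Fin N)) where
  open Graph G

  degree : Fin N → ℕ
  degree u = length (filter (adj? u) (allFin N))

  Regular : ℕ → Set
  Regular k = ∀ u → degree u ≡ k

  -- Membership in ∁ S, unlike non-membership in S, has unique proofs
  -- without function extensionality, so no vertex is duplicated.
  delete : (S : Subset N) → Graph (∃[ v ] v ∈ ∁ S)
  delete S = record
    { Adj        = Adj on proj₁
    ; adj?       = λ u v → adj? (proj₁ u) (proj₁ v)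
    ; adj-sym    = adj-sym
    ; adj-irrefl = adj-irrefl
    }

  Disconnects : Subset N → Set
  Disconnects S = ¬ Connected (delete S)

  -- A complete graph has no disconnecting set, hence no vertex
  -- connectivity in this sense; it has diameter at most 1.
  HasVertexConnectivity : ℕ → Set
  HasVertexConnectivity p =
    (∃[ S ] (Disconnects S × ∣ S ∣ ≡ p)) ×
    (∀ S → Disconnects S → p ≤ ∣ S ∣)

  Block : Set
  Block = ∃[ p ] (1 < p × HasVertexConnectivity p)

{-# OPTIONS --safe #-}
-- Take a symmetric (v, k, 3) design with k = n + 1; one exists for k = 4, 6, 7,
-- 9, 10, 12, 15, with v = 5, 11, 15, 25, 31, 45, 71.  The vertices of the graph are
-- the points and the flags (incident point–line pairs) of the design, lines being
-- its blocks; a point is joined to the flags containing it, and two flags are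
-- joined when they share their line.  Every degree is k.  At distance 4, and between
-- two points, a geodesic is determined by a line through two given points or by a
-- point on two given lines, so there are at most three; other pairs have at most
-- two.  If fewer than k vertices are deleted, every line still has a point that
-- survives together with all of its flags; any two such points are joined through
-- a common line, and every surviving vertex can reach one of them.
module Submission where

open import Defs
open import Data.Bool.Base using (true; false)
open import Data.Empty using (⊥)
open import Data.Fin.Base using (Fin; zero; suc; toℕ; fromℕ<; punchIn; punchOut)
import Data.Fin.Properties as Fin
open import Data.Fin.Subset using (Subset; _∈_; ∁; ∣_∣; inside; outside)
open import Data.Fin.Subset.Properties using (_∈?_; x∉p⇒x∈∁p; x∉∁p⇒x∈p; x∈p⇒x∉∁p)
open import Data.List.Base using (List; []; _∷_; _++_; allFin; filter; head; last; length; map; tabulate)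
import Data.List.Membership.DecPropositional as DecMembership
open import Data.List.Membership.Propositional using () renaming (_∈_ to _∈ˡ_; _∉_ to _∉ˡ_)
open import Data.List.Membership.Propositional.Properties using (∈-∃++; ∈-++⁻; ∈-++⁺ˡ; ∈-++⁺ʳ; ∈-map⁺; ∈-map⁻; ∈-filter⁺; ∈-filter⁻; ∈-allFin; ∈-tabulate⁺; ∈-tabulate⁻)
open import Data.List.Properties using (length-map; length-++; length-tabulate; head-map; last-map; map-injective; map-tabulate)
import Data.List.Relation.Unary.All as All
open import Data.List.Relation.Unary.All using (All; []; _∷_)
import Data.List.Relation.Unary.All.Properties as All
open import Data.List.Relation.Unary.AllPairs using ([]; _∷_)
open import Data.List.Relation.Unary.Any using (here; there)
import Data.List.Relation.Unary.Linked as Linked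
open import Data.List.Relation.Unary.Linked using (Linked; [-]; _∷_)
import Data.List.Relation.Unary.Linked.Properties as Linked
open import Data.List.Relation.Unary.Unique.Propositional using (Unique)
import Data.List.Relation.Unary.Unique.Propositional.Properties as Unique
import Data.Maybe.Base as Maybe
open import Data.Maybe.Base using (just)
open import Data.Nat.Base using (ℕ; zero; suc; _+_; _*_; _∸_; _%_; _≤_; _<_; z≤n; s≤s; NonZero)
import Data.Nat.Properties as ℕ
open import Data.Nat.Properties using (_<?_; ≤-refl; ≤-trans; ≤-antisym; ≤-reflexive; +-suc; +-identityʳ; *-identityʳ; +-mono-≤; suc-injective; m≤n⇒m≤1+n; ≮⇒≥; ≤⇒≯)
open import Data.Product.Base using (∃; ∃-syntax; Σ-syntax; _×_; _,_; proj₁; proj₂)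
open import Data.Product.Properties using (≡-dec)
open import Data.Sum.Base using (_⊎_; inj₁; inj₂)
open import Data.Sum.Function.Propositional using (_⊎-↔_)
import Data.Sum.Properties as Sum
open import Data.Sum.Properties using (inj₂-injective)
import Data.Vec.Base as Vec
open import Data.Vec.Base using (Vec; []; _∷_; lookup)
import Data.Vec.Properties as Vec
open import Data.Vec.Properties.WithK using ([]=-irrelevant)
open import Function.Base using (_∘_; id; case_of_)
open import Function.Bundles using (_↔_; Inverse)
open import Function.Construct.Composition using (_↔-∘_)
open import Function.Construct.Identity using (↔-id)
open import Function.Definitions using (Injective)
open import Level using (0ℓ)
open import Relation.Binary.Construct.Closure.ReflexiveTransitive using (Star; _◅_; _◅◅_; reverse) renaming (ε to done)
open import Relation.Binary.Definitions using (DecidableEquality)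
open import Relation.Binary.PropositionalEquality
open import Relation.Nullary using (¬_; Dec; yes; no; does; contradiction; ¬?)
open import Relation.Nullary.Decidable using (dec-true; dec-false; decidable-stable; from-yes; map′; _×-dec_; _⊎-dec_; _→-dec_)
open import Relation.Unary using (Pred; Decidable)

-- In a symmetric (v, k, 3) design v = 1 + k(k - 1)/3, so 3 divides k(k - 1); for k = n + 1 this is
-- the congruence on n. The value n = 12 would call for a (53, 13, 3) design, which the
-- Bruck-Ryser-Chowla theorem rules out. The graph arises from the incidence graph, which is
-- k-regular of diameter 3, by replacing each line vertex with a clique on the k edges at it.
-- Crossing a line then costs one edge more, which raises the diameter to 4. The bound of three
-- leaves room for only one branching along a geodesic: once a line or a common point has been
-- chosen out of three, the rest must be forced. Hence the uniqueness lemmas for distances 2 and 3.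
-- The largest graph has 71 + 71 * 15 = 1136 vertices, so nothing is computed on it. Evaluation
-- checks only the design tables; distances, geodesics and connectivity are derived from the
-- incidence axioms.

private
  variable
    A     : Set
    v k n : ℕ

-- Counting with lists free of repetition

∈-remove : ∀ {x : A} {xs} ys {zs} → All (x ≢_) xs → (∀ {w} → w ∈ˡ x ∷ xs → w ∈ˡ ys ++ x ∷ zs) →
  ∀ {w} → w ∈ˡ xs → w ∈ˡ ys ++ zs
∈-remove ys x≢ sub w∈ with ∈-++⁻ ys (sub (there w∈))
... | inj₁ w∈ys         = ∈-++⁺ˡ w∈ys
... | inj₂ (here refl)  = contradiction refl (All.lookup x≢ w∈)
... | inj₂ (there w∈zs) = ∈-++⁺ʳ ys w∈zs

unique-⊆⇒length-≤ : ∀ {xs ys : List A} → Unique xs → (∀ {x} → x ∈ˡ xs → x ∈ˡ ys) → length xs ≤ length ys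
unique-⊆⇒length-≤ [] sub = z≤n
unique-⊆⇒length-≤ {xs = x ∷ xs} (x≢ ∷ u) sub with ∈-∃++ (sub (here refl))
... | ys , zs , refl = ≤-trans (s≤s (unique-⊆⇒length-≤ u (∈-remove ys x≢ sub)))
  (≤-reflexive (begin
    suc (length (ys ++ zs))       ≡⟨ cong suc (length-++ ys) ⟩
    suc (length ys + length zs)   ≡⟨ +-suc (length ys) (length zs) ⟨
    length ys + suc (length zs)   ≡⟨ length-++ ys ⟨
    length (ys ++ x ∷ zs)         ∎))
  where open ≡-Reasoning

unique-≡⇒length-≡ : ∀ {xs ys : List A} → Unique xs → Unique ys →
  (∀ {x} → x ∈ˡ xs → x ∈ˡ ys) → (∀ {x} → x ∈ˡ ys → x ∈ˡ xs) → length xs ≡ length ys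
unique-≡⇒length-≡ u v s t = ≤-antisym (unique-⊆⇒length-≤ u s) (unique-⊆⇒length-≤ v t)

-- Walks and certified distances

module _ {V : Set} (G : Graph V) where
  open Graph G

  -- Distinctness of vertices is lost when an edge is prepended, so walks drop it and can be built
  -- edge by edge; `shorten` restores it at the end.
  data Walk : V → V → List V → Set where
    [-] : ∀ {u} → Walk u u (u ∷ [])
    _∷_ : ∀ {u w v vs} → Adj u w → Walk w v vs → Walk u v (u ∷ vs)

  path⇒walk : ∀ {u v vs} → IsPath G u v vs → Walk u v vs
  path⇒walk (mkPath s e l d) = go s e l
    where
    go : ∀ {u v vs} → head vs ≡ just u → last vs ≡ just v → Linked Adj vs → Walk u v vs
    go refl refl [-]     = [-]
    go refl e    (a ∷ l) = a ∷ go refl e l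

  walk⇒path : ∀ {u v vs} → Walk u v vs → Unique vs → IsPath G u v vs
  walk⇒path w d = mkPath (starts w) (ends w) (linked w) d
    where
    starts : ∀ {u v vs} → Walk u v vs → head vs ≡ just u
    starts [-]     = refl
    starts (_ ∷ _) = refl
    ends : ∀ {u v vs} → Walk u v vs → last vs ≡ just v
    ends [-]                 = refl
    ends (_ ∷ [-])           = refl
    ends (_ ∷ w@(_ ∷ _))     = ends w
    linked : ∀ {u v vs} → Walk u v vs → Linked Adj vs
    linked [-]             = [-]
    linked (a ∷ [-])       = a ∷ [-]
    linked (a ∷ w@(_ ∷ _)) = a ∷ linked w

  module _ (_≟_ : DecidableEquality V) where
    open DecMembership _≟_ using () renaming (_∈?_ to _∈ˡ?_)

    from-visited : ∀ {u w v vs} → u ∈ˡ vs → Walk w v vs → Unique vs →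
      ∃[ us ] (Walk u v us × Unique us × length us ≤ length vs)
    from-visited (here refl) [-]     d       = _ , [-] , d , ≤-refl
    from-visited (here refl) (a ∷ w) d       = _ , a ∷ w , d , ≤-refl
    from-visited (there u∈)  (a ∷ w) (_ ∷ d) =
      let us , w′ , d′ , le = from-visited u∈ w d in us , w′ , d′ , m≤n⇒m≤1+n le

    -- Shorten the rest of the walk first; if the initial vertex occurs in the result, restart from
    -- that occurrence.
    shorten : ∀ {u v vs} → Walk u v vs → ∃[ us ] (IsPath G u v us × length us ≤ length vs)
    shorten w = let us , w′ , d , le = go w in us , walk⇒path w′ d , le
      where
      go : ∀ {u v vs} → Walk u v vs → ∃[ us ] (Walk u v us × Unique us × length us ≤ length vs)
      go [-] = _ , [-] , ([] ∷ []) , ≤-refl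
      go {u} (a ∷ w) with go w
      ... | us , w′ , d , le with u ∈ˡ? us
      ... | no  u∉us = _ , a ∷ w′ , All.¬Any⇒All¬ us u∉us ∷ d , s≤s le
      ... | yes u∈us =
        let ts , w″ , d″ , le″ = from-visited u∈us w′ d
        in  ts , w″ , d″ , m≤n⇒m≤1+n (≤-trans le″ le)

-- An upper bound on a number of elements without an enumeration: the list may contain repetitions
-- and elements outside `P`, so covers can be concatenated freely.
Covered : ℕ → Pred A 0ℓ → Set
Covered n P = ∃[ xs ] (length xs ≤ n × ∀ {x} → P x → x ∈ˡ xs)

-- Local conditions that force Dist to be the graph distance, so that geodesics can
-- be enumerated one step at a time.
record Metric {V : Set} (G : Graph V) : Set₁ where
  open Graph G
  field
    Dist    : V → V → ℕ → Set
    total   : ∀ u v → ∃ (Dist u v)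
    zero⇒≡  : ∀ {u v} → Dist u v 0 → u ≡ v
    self⇒0  : ∀ {v d} → Dist v v d → d ≡ 0
    step    : ∀ {u v w d e} → Dist u v d → Adj u w → Dist w v e → d ≤ suc e
    descend : ∀ {u v d} → Dist u v (suc d) → ∃[ w ] (Adj u w × Dist w v d)

  lower : ∀ {u v d vs} → Walk G u v vs → Dist u v d → d < length vs
  lower [-] δ rewrite self⇒0 δ = s≤s z≤n
  lower {v = v} (_∷_ {w = w} a ω) δ with total w v
  ... | e , ε = s≤s (≤-trans (step δ a ε) (lower ω ε))

  attain : ∀ {u v} d → Dist u v d → ∃[ vs ] (Walk G u v vs × length vs ≡ suc d)
  attain zero    δ rewrite zero⇒≡ δ = _ , [-] , refl
  attain (suc d) δ =
    let w , a , ε = descend δ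
        vs , ω , eq = attain d ε
    in  _ , a ∷ ω , cong suc eq

  Dist-≤ : ∀ {u v d e} → Dist u v d → Dist u v e → d ≤ e
  Dist-≤ δ ε with attain _ ε
  ... | vs , ω , eq with lower ω δ
  ... | lt rewrite eq with lt
  ... | s≤s le = le

  Dist-functional : ∀ {u v d e} → Dist u v d → Dist u v e → d ≡ e
  Dist-functional δ ε = ≤-antisym (Dist-≤ δ ε) (Dist-≤ ε δ)

  Geodesic : V → V → ℕ → List V → Set
  Geodesic u v d vs = Walk G u v vs × length vs ≡ suc d

  -- The distance of the next vertex is squeezed: `lower` on the remaining walk bounds it by `d`
  -- from above, `step` from below.
  geodesic-tail : ∀ {u v d vs} → Dist u v (suc d) → Geodesic u v (suc d) vs →
    ∃[ w ] ∃[ ws ] (Adj u w × Dist w v d × Geodesic w v d ws × vs ≡ u ∷ ws)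
  geodesic-tail {v = v} δ (_∷_ {w = w} a ω , eq) with total w v
  ... | e , ε with lower ω ε | step δ a ε
  ... | lt | s≤s le rewrite suc-injective eq with lt
  ... | s≤s ge rewrite ≤-antisym ge le = w , _ , a , ε , (ω , suc-injective eq) , refl

  module _ (_≟_ : DecidableEquality V) where

    shortest⇒geodesic : ∀ {u v d vs} → Dist u v d → IsShortestPath G u v vs → Geodesic u v d vs
    shortest⇒geodesic {d = d} δ (π , min) with attain d δ
    -- The walk from `attain` is not known to be free of repetition, while minimality of a shortest
    -- path compares only with paths.
    ... | ws , ω , eq with shorten G _≟_ ω
    ... | us , ρ , le = path⇒walk G π ,
      ≤-antisym (≤-trans (min us ρ) (≤-trans le (≤-reflexive eq))) (lower (path⇒walk G π) δ)

    hasDistance : ∀ {u v d} → Dist u v d → HasDistance G u v d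
    hasDistance {d = d} δ with attain d δ
    ... | ws , ω , eq with shorten G _≟_ ω
    ... | us , ρ , le = us , (ρ , λ ts τ → ≤-trans (≤-trans le (≤-reflexive eq)) (lower (path⇒walk G τ) δ)) ,
      ≤-antisym (≤-trans le (≤-reflexive eq)) (lower (path⇒walk G ρ) δ)

    hasDiameter : ∀ {D} → (∀ {u v d} → Dist u v d → d ≤ D) → ∃[ u ] ∃[ v ] Dist u v D → HasDiameter G D
    hasDiameter bound (u , v , δ) =
      (λ x y → let d , ε = total x y in d , hasDistance ε , bound ε) , u , v , hasDistance δ

    trigeodetic : (∀ {u v d} → Dist u v d → Covered 3 (Geodesic u v d)) → Trigeodetic G
    trigeodetic cov u v _ _ ps up shortest with total u v
    ... | d , δ with cov δ
    ... | xs , le , f = ≤-trans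
      (unique-⊆⇒length-≤ up (λ p∈ → f (shortest⇒geodesic δ (All.lookup shortest p∈)))) le

  -- Geodesics are sorted by their first step: `W` lists the candidates, and each continues in at
  -- most `b` ways.
  cover-via : ∀ {u v d b} (W : List V) → (∀ {w} → Adj u w → Dist w v d → w ∈ˡ W) →
    (∀ {w} → Adj u w → Dist w v d → Covered b (Geodesic w v d)) →
    Dist u v (suc d) → Covered (length W * b) (Geodesic u v (suc d))
  cover-via {u} {v} {d} {b} W next cov δ =
    let xs , le , f = collect W in
    xs , le , λ γ → case geodesic-tail δ γ of λ where
      (w , ws , a , ε , γ′ , refl) → f (next a ε) a ε γ′
    where
    from : ∀ w → ∃[ xs ] (length xs ≤ b × (∀ {ws} → Adj u w → Dist w v d → Geodesic w v d ws → u ∷ ws ∈ˡ xs))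
    from w with total w v
    ... | e , ε with adj? u w ×-dec (e ℕ.≟ d)
    -- A candidate that starts no geodesic contributes the empty list.
    ... | no ¬p = [] , z≤n , λ a ε′ _ → contradiction (a , Dist-functional ε ε′) ¬p
    ... | yes (a , refl) with cov a ε
    ... | xs , le , f = map (u ∷_) xs , ≤-trans (≤-reflexive (length-map (u ∷_) xs)) le ,
      λ _ _ γ → ∈-map⁺ (u ∷_) (f γ)
    collect : ∀ W → ∃[ xs ] (length xs ≤ length W * b ×
      (∀ {w ws} → w ∈ˡ W → Adj u w → Dist w v d → Geodesic w v d ws → u ∷ ws ∈ˡ xs))
    collect [] = [] , z≤n , λ ()
    collect (w ∷ W) =
      let xs , le , f = from w
          ys , le′ , g = collect W
      in  xs ++ ys , ≤-trans (≤-reflexive (length-++ xs)) (+-mono-≤ le le′) , λ where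
            (here refl) a ε γ → ∈-++⁺ˡ (f a ε γ)
            (there w∈)  a ε γ → ∈-++⁺ʳ xs (g w∈ a ε γ)

  cover-unique : ∀ {u v d b} → (∀ {w w′} → Adj u w → Dist w v d → Adj u w′ → Dist w′ v d → w′ ≡ w) →
    (∀ {w} → Adj u w → Dist w v d → Covered b (Geodesic w v d)) →
    Dist u v (suc d) → Covered b (Geodesic u v (suc d))
  cover-unique {b = b} uniq cov δ =
    let w , a , ε = descend δ
        xs , le , f = cover-via (w ∷ []) (λ a′ ε′ → here (uniq a ε a′ ε′)) cov δ
    in  xs , ≤-trans le (≤-reflexive (+-identityʳ b)) , f

  cover-0 : ∀ {u v} → Covered 1 (Geodesic u v 0)
  cover-0 {u} = (u ∷ []) ∷ [] , s≤s z≤n , λ where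
    ([-] , _)         → here refl
    (_ ∷ [-] , ())
    (_ ∷ (_ ∷ _) , ())

  cover-1 : ∀ {u v} → Dist u v 1 → Covered 1 (Geodesic u v 1)
  cover-1 = cover-unique (λ _ ε _ ε′ → trans (zero⇒≡ ε′) (sym (zero⇒≡ ε))) (λ _ _ → cover-0)

-- Transport of metric properties along a bijection

path-map : ∀ {A B : Set} (G : Graph A) (H : Graph B) (f : A → B) → Injective _≡_ _≡_ f →
  (∀ {x y} → Graph.Adj G x y → Graph.Adj H (f x) (f y)) →
  ∀ {u v vs} → IsPath G u v vs → IsPath H (f u) (f v) (map f vs)
path-map G H f inj hom {vs = vs} (mkPath s e l d) = mkPath
  (trans (head-map vs) (cong (Maybe.map f) s))
  (trans (last-map f vs) (cong (Maybe.map f) e))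
  (Linked.map⁺ (Linked.map hom l))
  (Unique.map⁺ inj d)

-- Degrees and deletion are stated for vertices in `Fin N`, while the geometry lives on points and
-- flags; the bijection moves results from the latter to the former.
module Pullback {A V : Set} (H : Graph V) (iso : A ↔ V) where
  open Inverse iso using (to; from; strictlyInverseˡ; strictlyInverseʳ)

  private module H = Graph H

  pullback : Graph A
  pullback = record
    { Adj        = λ x y → H.Adj (to x) (to y)
    ; adj?       = λ x y → H.adj? (to x) (to y)
    ; adj-sym    = H.adj-sym
    ; adj-irrefl = H.adj-irrefl
    }

  to-injective : Injective _≡_ _≡_ to
  to-injective {x} {y} eq = trans (sym (strictlyInverseʳ x)) (trans (cong from eq) (strictlyInverseʳ y))

  from-injective : Injective _≡_ _≡_ from
  from-injective {x} {y} eq = trans (sym (strictlyInverseˡ x)) (trans (cong to eq) (strictlyInverseˡ y))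

  to-path : ∀ {x y vs} → IsPath pullback x y vs → IsPath H (to x) (to y) (map to vs)
  to-path = path-map pullback H to to-injective id

  from-path : ∀ {x y vs} → IsPath H x y vs → IsPath pullback (from x) (from y) (map from vs)
  from-path = path-map H pullback from from-injective
    λ {x} {y} → subst₂ H.Adj (sym (strictlyInverseˡ x)) (sym (strictlyInverseˡ y))

  to-shortest : ∀ {x y vs} → IsShortestPath pullback x y vs → IsShortestPath H (to x) (to y) (map to vs)
  to-shortest {x} {y} {vs} (π , min) = to-path π , λ ws τ → ≤-trans (≤-reflexive (length-map to vs))
    (≤-trans (min _ (subst₂ (λ a b → IsPath pullback a b (map from ws)) (strictlyInverseʳ x) (strictlyInverseʳ y) (from-path τ)))
      (≤-reflexive (length-map from ws)))

  from-shortest : ∀ {x y vs} → IsShortestPath H x y vs → IsShortestPath pullback (from x) (from y) (map from vs)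
  from-shortest {x} {y} {vs} (π , min) = from-path π , λ ws τ → ≤-trans (≤-reflexive (length-map from vs))
    (≤-trans (min _ (subst₂ (λ a b → IsPath H a b (map to ws)) (strictlyInverseˡ x) (strictlyInverseˡ y) (to-path τ)))
      (≤-reflexive (length-map to ws)))

  from-distance : ∀ {x y d} → HasDistance H x y d → HasDistance pullback (from x) (from y) d
  from-distance (vs , π , eq) = map from vs , from-shortest π , trans (length-map from vs) eq

  pullback-diameter : ∀ {D} → HasDiameter H D → HasDiameter pullback D
  pullback-diameter (dist , u , v , far) =
    (λ x y → let d , δ , le = dist (to x) (to y) in
      d , subst₂ (λ a b → HasDistance pullback a b d) (strictlyInverseʳ x) (strictlyInverseʳ y) (from-distance δ) , le) ,
    from u , from v , from-distance far

  pullback-trigeodetic : Trigeodetic H → Trigeodetic pullback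
  pullback-trigeodetic tri u v u≢v ¬adj ps unique shortest = ≤-trans (≤-reflexive (sym (length-map (map to) ps)))
    (tri (to u) (to v) (u≢v ∘ to-injective) ¬adj (map (map to) ps)
      (Unique.map⁺ (map-injective to-injective) unique) (All.map⁺ (All.map to-shortest shortest)))

-- Counting vertices and deleting them

module _ {N : ℕ} where

  ∣tabulate∣ : ∀ {M} {P : Pred (Fin N) 0ℓ} (P? : Decidable P) (f : Fin M → Fin N) →
    ∣ Vec.tabulate (does ∘ P? ∘ f) ∣ ≡ length (filter P? (tabulate f))
  ∣tabulate∣ {zero}  P? f = refl
  ∣tabulate∣ {suc M} P? f with does (P? (f zero)) | ∣tabulate∣ P? (f ∘ suc)
  ... | inside  | ih = cong suc ih
  ... | outside | ih = ih

  count-≡ : ∀ {P : Pred (Fin N) 0ℓ} (P? : Decidable P) {xs} → Unique xs →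
    (∀ {x} → P x → x ∈ˡ xs) → (∀ {x} → x ∈ˡ xs → P x) → length (filter P? (allFin N)) ≡ length xs
  count-≡ P? u sound complete = unique-≡⇒length-≡ (Unique.filter⁺ P? (Unique.allFin⁺ N)) u
    (sound ∘ proj₂ ∘ ∈-filter⁻ P? {xs = allFin N}) (∈-filter⁺ P? (∈-allFin _) ∘ complete)

  injection⇒≤∣S∣ : ∀ {k} (S : Subset N) (f : Fin k → Fin N) → Injective _≡_ _≡_ f → (∀ i → f i ∈ S) → k ≤ ∣ S ∣
  injection⇒≤∣S∣ {k} S f inj f∈S = ≤-trans (≤-reflexive (sym (length-tabulate f)))
    (≤-trans (unique-⊆⇒length-≤ (Unique.tabulate⁺ inj) sub) (≤-reflexive size))
    where
    sub : ∀ {x} → x ∈ˡ tabulate f → x ∈ˡ filter (_∈? S) (allFin N)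
    sub x∈ with ∈-tabulate⁻ x∈
    ... | i , refl = ∈-filter⁺ (_∈? S) (∈-allFin _) (f∈S i)
    does-∈? : ∀ {n} (S : Subset n) (x : Fin n) → does (x ∈? S) ≡ lookup S x
    does-∈? (inside  ∷ S) zero    = refl
    does-∈? (outside ∷ S) zero    = refl
    does-∈? (_       ∷ S) (suc x) = does-∈? S x
    size : length (filter (_∈? S) (allFin N)) ≡ ∣ S ∣
    size = trans (sym (∣tabulate∣ (_∈? S) id))
      (cong ∣_∣ (trans (Vec.tabulate-cong (does-∈? S)) (Vec.tabulate∘lookup S)))

  -- Pigeonhole: if every class met `S`, a choice of one deleted vertex per class would be injective
  -- by disjointness, giving `k` elements of `S`.
  untouched : ∀ {k} (S : Subset N) → ∣ S ∣ < k → (C : Fin k → Pred (Fin N) 0ℓ) → (∀ i → Decidable (C i)) →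
    (∀ {i j x} → C i x → C j x → i ≡ j) → ∃[ i ] (∀ x → C i x → x ∈ ∁ S)
  untouched {k} S small C C? disjoint = decidable-stable (Fin.any? avoids?) λ none →
    let touched : ∀ i → ∃[ x ] (C i x × x ∈ S)
        touched i =
          let x , ¬imp = Fin.¬∀⟶∃¬ N _ (λ x → C? i x →-dec (x ∈? ∁ S)) (λ all → none (i , all))
              x∈S = x∉∁p⇒x∈p λ x∈∁ → ¬imp λ _ → x∈∁
          in  x , decidable-stable (C? i x) (λ ¬c → ¬imp λ c → contradiction c ¬c) , x∈S
    in  ≤⇒≯ (injection⇒≤∣S∣ S (proj₁ ∘ touched)
          (λ {i} {j} eq → disjoint (proj₁ (proj₂ (touched i))) (subst (C j) (sym eq) (proj₁ (proj₂ (touched j)))))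
          (proj₂ ∘ proj₂ ∘ touched)) small
    where
    avoids? : ∀ i → Dec (∀ x → C i x → x ∈ ∁ S)
    avoids? i = Fin.all? λ x → C? i x →-dec (x ∈? ∁ S)

module _ {N : ℕ} (G : Graph (Fin N)) where
  open Graph G

  neighbourhood : Fin N → Subset N
  neighbourhood u = Vec.tabulate (does ∘ adj? u)

  ∣neighbourhood∣ : ∀ u → ∣ neighbourhood u ∣ ≡ degree G u
  ∣neighbourhood∣ u = ∣tabulate∣ (adj? u) id

  ∈-neighbourhood : ∀ {u v} → Adj u v → v ∈ neighbourhood u
  ∈-neighbourhood {u} {v} a = Vec.lookup⇒[]= v _ (trans (Vec.lookup∘tabulate _ v) (dec-true (adj? u v) a))

  ∉-neighbourhood : ∀ {u v} → ¬ Adj u v → v ∈ ∁ (neighbourhood u)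
  ∉-neighbourhood {u} {v} ¬a = x∉p⇒x∈∁p λ v∈ →
    contradiction (trans (sym (dec-false (adj? u v) ¬a)) (trans (sym (Vec.lookup∘tabulate _ v)) (Vec.[]=⇒lookup v∈))) λ ()

  -- `u` itself survives, being no neighbour of itself, but the first edge of any walk leaving it
  -- leads to a deleted vertex.
  neighbourhood-disconnects : ∀ {u v} → u ≢ v → ¬ Adj u v → Disconnects G (neighbourhood u)
  neighbourhood-disconnects {u} {v} u≢v ¬a connected =
    isolated refl u≢v (path⇒walk (delete G (neighbourhood u))
      (proj₂ (connected (u , ∉-neighbourhood adj-irrefl) (v , ∉-neighbourhood ¬a))))
    where
    isolated : ∀ {x y vs} → proj₁ x ≡ u → u ≢ proj₁ y → ¬ Walk (delete G (neighbourhood u)) x y vs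
    isolated x≡ u≢y [-]                         = u≢y (sym x≡)
    isolated refl _ (_∷_ {w = w , w∈∁} a _) = x∈p⇒x∉∁p (∈-neighbourhood a) w∈∁

  reachable⇒connected : (S : Subset N) → (∀ u v → Star (Graph.Adj (delete G S)) u v) → Connected (delete G S)
  reachable⇒connected S reach u v =
    let vs , w = walk (reach u v)
        us , π , _ = shorten (delete G S) _≟_ w
    in  us , π
    where
    walk : ∀ {u v} → Star (Graph.Adj (delete G S)) u v → ∃ (Walk (delete G S) u v)
    walk done    = _ , [-]
    walk (a ◅ r) = let _ , w = walk r in _ , a ∷ w
    _≟_ : DecidableEquality (∃[ v ] v ∈ ∁ S)
    (u , u∈) ≟ (v , v∈) with u Fin.≟ v
    ... | yes refl = yes (cong (u ,_) ([]=-irrelevant u∈ v∈))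
    ... | no u≢v   = no λ { refl → u≢v refl }

  hasVertexConnectivity : ∀ {k u v} → Regular G k → u ≢ v → ¬ Adj u v →
    (∀ S → ∣ S ∣ < k → ∀ x y → Star (Graph.Adj (delete G S)) x y) → HasVertexConnectivity G k
  hasVertexConnectivity {u = u} regular u≢v ¬a reach =
    (neighbourhood u , neighbourhood-disconnects u≢v ¬a , trans (∣neighbourhood∣ u) (regular u)) ,
    λ S disc → ≮⇒≥ λ small → disc (reachable⇒connected S (reach S small))

-- The graph of points and flags of an incidence structure

-- Flags form a type of their own rather than pairs with a proof of incidence; `flag-≡` keeps them
-- determined by point and line.
record Incidence : Set₁ where
  field
    Point Line Flag : Set
    _≟ᴾ_  : DecidableEquality Point
    _≟ᴸ_  : DecidableEquality Line
    _≟ᶠ_  : DecidableEquality Flag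
    point : Flag → Point
    line  : Flag → Line
    flag-≡ : ∀ {f g} → point f ≡ point g → line f ≡ line g → f ≡ g

  On : Point → Line → Set
  On p b = ∃[ f ] (point f ≡ p × line f ≡ b)

  field
    on? : ∀ p b → Dec (On p b)

module FlagGraph (I : Incidence) where
  open Incidence I

  Vertex : Set
  Vertex = Point ⊎ Flag

  Adjacent : Vertex → Vertex → Set
  Adjacent (inj₁ p) (inj₁ q) = ⊥
  Adjacent (inj₁ p) (inj₂ g) = point g ≡ p
  Adjacent (inj₂ f) (inj₁ q) = point f ≡ q
  Adjacent (inj₂ f) (inj₂ g) = line f ≡ line g × f ≢ g

  flagGraph : Graph Vertex
  flagGraph = record
    { Adj        = Adjacent
    ; adj?       = adjacent?
    ; adj-sym    = λ {x} {y} → symmetric {x} {y}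
    ; adj-irrefl = λ {x} → irreflexive {x}
    }
    where
    adjacent? : ∀ x y → Dec (Adjacent x y)
    adjacent? (inj₁ p) (inj₁ q) = no λ ()
    adjacent? (inj₁ p) (inj₂ g) = point g ≟ᴾ p
    adjacent? (inj₂ f) (inj₁ q) = point f ≟ᴾ q
    adjacent? (inj₂ f) (inj₂ g) = (line f ≟ᴸ line g) ×-dec ¬? (f ≟ᶠ g)
    symmetric : ∀ {x y} → Adjacent x y → Adjacent y x
    symmetric {inj₁ p} {inj₂ g} a = a
    symmetric {inj₂ f} {inj₁ q} a = a
    symmetric {inj₂ f} {inj₂ g} (b≡ , f≢) = sym b≡ , f≢ ∘ sym
    irreflexive : ∀ {x} → ¬ Adjacent x x
    irreflexive {inj₂ f} (_ , f≢f) = f≢f refl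

  -- Constructor names give the kinds of the two vertices (point or flag) and
  -- their distance.
  data Dist : Vertex → Vertex → ℕ → Set where
    pp0 : ∀ {p}   → Dist (inj₁ p) (inj₁ p) 0
    pp3 : ∀ {p q} → p ≢ q → Dist (inj₁ p) (inj₁ q) 3
    pf1 : ∀ {p g} → point g ≡ p → Dist (inj₁ p) (inj₂ g) 1
    pf2 : ∀ {p g} → point g ≢ p → On p (line g) → Dist (inj₁ p) (inj₂ g) 2
    pf4 : ∀ {p g} → ¬ On p (line g) → Dist (inj₁ p) (inj₂ g) 4
    fp1 : ∀ {f q} → point f ≡ q → Dist (inj₂ f) (inj₁ q) 1
    fp2 : ∀ {f q} → point f ≢ q → On q (line f) → Dist (inj₂ f) (inj₁ q) 2
    fp4 : ∀ {f q} → ¬ On q (line f) → Dist (inj₂ f) (inj₁ q) 4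
    ff0 : ∀ {f}   → Dist (inj₂ f) (inj₂ f) 0
    ff1 : ∀ {f g} → f ≢ g → line f ≡ line g → Dist (inj₂ f) (inj₂ g) 1
    ff2 : ∀ {f g} → line f ≢ line g → point f ≡ point g → Dist (inj₂ f) (inj₂ g) 2
    ff3 : ∀ {f g} → line f ≢ line g → point f ≢ point g →
          On (point f) (line g) ⊎ On (point g) (line f) → Dist (inj₂ f) (inj₂ g) 3
    ff4 : ∀ {f g} → ¬ On (point f) (line g) → ¬ On (point g) (line f) → Dist (inj₂ f) (inj₂ g) 4

  dist-total : ∀ x y → ∃ (Dist x y)
  dist-total (inj₁ p) (inj₁ q) with p ≟ᴾ q
  ... | yes refl = _ , pp0
  ... | no p≢q   = _ , pp3 p≢q
  dist-total (inj₁ p) (inj₂ g) with point g ≟ᴾ p | on? p (line g)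
  ... | yes eq | _        = _ , pf1 eq
  ... | no ne  | yes p∈g  = _ , pf2 ne p∈g
  ... | no ne  | no p∉g   = _ , pf4 p∉g
  dist-total (inj₂ f) (inj₁ q) with point f ≟ᴾ q | on? q (line f)
  ... | yes eq | _        = _ , fp1 eq
  ... | no ne  | yes q∈f  = _ , fp2 ne q∈f
  ... | no ne  | no q∉f   = _ , fp4 q∉f
  dist-total (inj₂ f) (inj₂ g) with f ≟ᶠ g | line f ≟ᴸ line g | point f ≟ᴾ point g
  ... | yes refl | _      | _      = _ , ff0
  ... | no f≢g   | yes b≡ | _      = _ , ff1 f≢g b≡
  ... | no f≢g   | no b≢  | yes p≡ = _ , ff2 b≢ p≡
  ... | no f≢g   | no b≢  | no p≢ with on? (point f) (line g) | on? (point g) (line f)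
  ... | yes f∈g | _       = _ , ff3 b≢ p≢ (inj₁ f∈g)
  ... | no f∉g  | yes g∈f = _ , ff3 b≢ p≢ (inj₂ g∈f)
  ... | no f∉g  | no g∉f  = _ , ff4 f∉g g∉f

  dist-zero : ∀ {x y} → Dist x y 0 → x ≡ y
  dist-zero pp0 = refl
  dist-zero ff0 = refl

  dist-self : ∀ {y d} → Dist y y d → d ≡ 0
  dist-self pp0         = refl
  dist-self (pp3 p≢p)   = contradiction refl p≢p
  dist-self ff0         = refl
  dist-self (ff1 f≢f _) = contradiction refl f≢f
  dist-self (ff2 b≢b _) = contradiction refl b≢b
  dist-self (ff3 b≢b _ _) = contradiction refl b≢b
  dist-self (ff4 {f} f∉ _) = contradiction (f , refl , refl) f∉

  1≤ : ∀ {n} → 1 ≤ suc n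
  1≤ = s≤s z≤n

  2≤ : ∀ {n} → 2 ≤ suc (suc n)
  2≤ = s≤s 1≤

  3≤ : ∀ {n} → 3 ≤ suc (suc (suc n))
  3≤ = s≤s 2≤

  4≤ : ∀ {n} → 4 ≤ suc (suc (suc (suc n)))
  4≤ = s≤s 3≤

  -- The contradictory cases are exactly those where one edge would lower the distance by two or
  -- more; each yields an equality or incidence that the constructor for `d` excludes.
  dist-step : ∀ {x y z d e} → Dist x y d → Adjacent x z → Dist z y e → d ≤ suc e
  dist-step pp0 _ _ = z≤n
  dist-step (pf1 _) _ _ = 1≤
  dist-step (fp1 _) _ _ = 1≤
  dist-step ff0 _ _ = z≤n
  dist-step (ff1 _ _) _ _ = 1≤
  dist-step {z = inj₂ _} (pp3 p≢q) refl (fp1 eq) = contradiction eq p≢q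
  dist-step {z = inj₂ _} (pp3 _) _ (fp2 _ _) = 3≤
  dist-step {z = inj₂ _} (pp3 _) _ (fp4 _) = 3≤
  dist-step {z = inj₂ _} (pf2 ne _) eq ff0 = contradiction eq ne
  dist-step {z = inj₂ _} (pf2 _ _) _ (ff1 _ _) = 2≤
  dist-step {z = inj₂ _} (pf2 _ _) _ (ff2 _ _) = 2≤
  dist-step {z = inj₂ _} (pf2 _ _) _ (ff3 _ _ _) = 2≤
  dist-step {z = inj₂ _} (pf2 _ _) _ (ff4 _ _) = 2≤
  dist-step {z = inj₂ f} (pf4 off) eq ff0 = contradiction (f , eq , refl) off
  dist-step {z = inj₂ f} (pf4 off) eq (ff1 _ b≡) = contradiction (f , eq , b≡) off
  dist-step {z = inj₂ f} (pf4 off) refl (ff2 {g = g} _ p≡) = contradiction (g , sym p≡ , refl) off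
  dist-step {z = inj₂ _} (pf4 _) _ (ff3 _ _ _) = 4≤
  dist-step {z = inj₂ _} (pf4 _) _ (ff4 _ _) = 4≤
  dist-step {z = inj₁ _} (fp2 ne _) eq pp0 = contradiction eq ne
  dist-step {z = inj₁ _} (fp2 _ _) _ (pp3 _) = 2≤
  dist-step {z = inj₂ _} (fp2 _ _) _ (fp1 _) = 2≤
  dist-step {z = inj₂ _} (fp2 _ _) _ (fp2 _ _) = 2≤
  dist-step {z = inj₂ _} (fp2 _ _) _ (fp4 _) = 2≤
  dist-step {z = inj₁ _} (fp4 {f} off) eq pp0 = contradiction (f , eq , refl) off
  dist-step {z = inj₁ _} (fp4 _) _ (pp3 _) = 4≤
  dist-step {z = inj₂ f′} (fp4 off) (b≡ , _) (fp1 eq) = contradiction (f′ , eq , sym b≡) off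
  dist-step {z = inj₂ _} (fp4 off) (b≡ , _) (fp2 _ on) = contradiction (subst (On _) (sym b≡) on) off
  dist-step {z = inj₂ _} (fp4 _) _ (fp4 _) = 4≤
  dist-step {z = inj₁ _} (ff2 _ _) _ (pf1 _) = 2≤
  dist-step {z = inj₁ _} (ff2 _ _) _ (pf2 _ _) = 2≤
  dist-step {z = inj₁ _} (ff2 _ _) _ (pf4 _) = 2≤
  dist-step {z = inj₂ _} (ff2 b≢ _) (b≡ , _) ff0 = contradiction b≡ b≢
  dist-step {z = inj₂ _} (ff2 _ _) _ (ff1 _ _) = 2≤
  dist-step {z = inj₂ _} (ff2 _ _) _ (ff2 _ _) = 2≤
  dist-step {z = inj₂ _} (ff2 _ _) _ (ff3 _ _ _) = 2≤
  dist-step {z = inj₂ _} (ff2 _ _) _ (ff4 _ _) = 2≤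
  dist-step {z = inj₁ _} (ff3 _ p≢ _) eq (pf1 eq′) = contradiction (trans eq (sym eq′)) p≢
  dist-step {z = inj₁ _} (ff3 _ _ _) _ (pf2 _ _) = 3≤
  dist-step {z = inj₁ _} (ff3 _ _ _) _ (pf4 _) = 3≤
  dist-step {z = inj₂ _} (ff3 b≢ _ _) (b≡ , _) ff0 = contradiction b≡ b≢
  dist-step {z = inj₂ _} (ff3 b≢ _ _) (b≡ , _) (ff1 _ b≡′) = contradiction (trans b≡ b≡′) b≢
  dist-step {z = inj₂ _} (ff3 _ _ _) _ (ff2 _ _) = 3≤
  dist-step {z = inj₂ _} (ff3 _ _ _) _ (ff3 _ _ _) = 3≤
  dist-step {z = inj₂ _} (ff3 _ _ _) _ (ff4 _ _) = 3≤
  dist-step {z = inj₁ _} (ff4 {g = g} off _) eq (pf1 eq′) = contradiction (g , trans eq′ (sym eq) , refl) off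
  dist-step {z = inj₁ _} (ff4 off _) refl (pf2 _ on) = contradiction on off
  dist-step {z = inj₁ _} (ff4 _ _) _ (pf4 _) = 4≤
  dist-step {z = inj₂ _} (ff4 {f} off _) (b≡ , _) ff0 = contradiction (f , refl , b≡) off
  dist-step {z = inj₂ _} (ff4 {f} off _) (b≡ , _) (ff1 _ b≡′) = contradiction (f , refl , trans b≡ b≡′) off
  dist-step {z = inj₂ f′} (ff4 _ off) (b≡ , _) (ff2 _ p≡) = contradiction (f′ , p≡ , sym b≡) off
  dist-step {z = inj₂ _} (ff4 _ _) _ (ff3 _ _ _) = 4≤
  dist-step {z = inj₂ _} (ff4 _ _) _ (ff4 _ _) = 4≤

  dist≤4 : ∀ {x y d} → Dist x y d → d ≤ 4
  dist≤4 pp0         = z≤n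
  dist≤4 (pp3 _)     = 3≤
  dist≤4 (pf1 _)     = 1≤
  dist≤4 (pf2 _ _)   = 2≤
  dist≤4 (pf4 _)     = 4≤
  dist≤4 (fp1 _)     = 1≤
  dist≤4 (fp2 _ _)   = 2≤
  dist≤4 (fp4 _)     = 4≤
  dist≤4 ff0         = z≤n
  dist≤4 (ff1 _ _)   = 1≤
  dist≤4 (ff2 _ _)   = 2≤
  dist≤4 (ff3 _ _ _) = 3≤
  dist≤4 (ff4 _ _)   = 4≤

  -- A line through `p` and `q` is represented by its flag at `p`, the first step of a geodesic
  -- towards `q`. Dually, `Meeting` represents a common point of two lines by its flag on the first.
  Joining : Point → Point → Flag → Set
  Joining p q f = point f ≡ p × On q (line f)

  Meeting : Line → Line → Flag → Set
  Meeting b c f = line f ≡ b × On (point f) c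

  module _ (joins : ∀ {p q} → p ≢ q → ∃ (Joining p q)) (meets : ∀ {b c} → b ≢ c → ∃ (Meeting b c)) where

    -- `joins` supplies the first step out of a point (`pp3`, `pf4`) and `meets` the one between
    -- flags at distance 4; every other first step is read off from the two vertices and their
    -- incidences.
    dist-descend : ∀ {x y d} → Dist x y (suc d) → ∃[ z ] (Adjacent x z × Dist z y d)
    dist-descend (pp3 p≢q) = let f , p≡ , q∈ = joins p≢q in inj₂ f , p≡ , fp2 (λ eq → p≢q (trans (sym p≡) eq)) q∈
    dist-descend (pf1 {g = g} eq) = inj₂ g , eq , ff0
    dist-descend (pf2 ne (h , p≡ , b≡)) = inj₂ h , p≡ , ff1 (λ { refl → ne p≡ }) b≡
    dist-descend (pf4 {p} {g} off) with joins {p} {point g} (λ { refl → off (g , refl , refl) })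
    ... | f , refl , g∈ = inj₂ f , refl , ff3 (λ b≡ → off (f , refl , b≡)) (λ p≡ → off (g , sym p≡ , refl)) (inj₂ g∈)
    dist-descend (fp1 {q = q} eq) = inj₁ q , eq , pp0
    dist-descend (fp2 ne (h , p≡ , b≡)) = inj₂ h , (sym b≡ , λ { refl → ne p≡ }) , fp1 p≡
    dist-descend (fp4 {f} off) = inj₁ (point f) , refl , pp3 (λ p≡ → off (f , p≡ , refl))
    dist-descend (ff1 {g = g} f≢g b≡) = inj₂ g , (b≡ , f≢g) , ff0
    dist-descend (ff2 {f} _ p≡) = inj₁ (point f) , refl , pf1 (sym p≡)
    dist-descend (ff3 {f} b≢ p≢ (inj₁ on)) = inj₁ (point f) , refl , pf2 (p≢ ∘ sym) on
    dist-descend (ff3 {f} b≢ p≢ (inj₂ (h , p≡ , b≡))) =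
      inj₂ h , (sym b≡ , λ { refl → p≢ p≡ }) , ff2 (λ b≡′ → b≢ (trans (sym b≡) b≡′)) p≡
    dist-descend (ff4 {f} {g} f∉ g∉) with meets (λ b≡ → f∉ (f , refl , b≡))
    ... | h , b≡ , h∈ = inj₂ h , (sym b≡ , λ { refl → f∉ h∈ }) ,
      ff3 (λ b≡′ → f∉ (f , refl , trans (sym b≡) b≡′)) (λ p≡ → g∉ (h , p≡ , b≡)) (inj₁ h∈)

    metric : Metric flagGraph
    metric = record
      { Dist    = Dist
      ; total   = dist-total
      ; zero⇒≡  = dist-zero
      ; self⇒0  = dist-self
      ; step    = dist-step
      ; descend = dist-descend
      }

    -- Counting geodesics in the flag graph

    open Metric metric using (Geodesic; cover-via; cover-unique; cover-0; cover-1)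

    -- The middle vertex is either a flag with prescribed point and line, or the common point of two
    -- flags on different lines.
    next-unique-2 : ∀ {x y z z′} → Dist x y 2 → Adjacent x z → Dist z y 1 → Adjacent x z′ → Dist z′ y 1 → z′ ≡ z
    next-unique-2 {z = inj₂ _} {inj₂ _} (pf2 _ _) p≡ (ff1 _ b≡) p≡′ (ff1 _ b≡′) =
      cong inj₂ (flag-≡ (trans p≡′ (sym p≡)) (trans b≡′ (sym b≡)))
    next-unique-2 {z = inj₂ _} {inj₂ _} (fp2 _ _) (b≡ , _) (fp1 p≡) (b≡′ , _) (fp1 p≡′) =
      cong inj₂ (flag-≡ (trans p≡′ (sym p≡)) (trans (sym b≡′) b≡))
    next-unique-2 {z = inj₁ _} {inj₁ _} (ff2 _ _) refl _ refl _ = refl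
    next-unique-2 {z = inj₁ _} {inj₂ _} (ff2 b≢ _) _ _ (b≡ , _) (ff1 _ b≡′) = contradiction (trans b≡ b≡′) b≢
    next-unique-2 {z = inj₂ _} (ff2 b≢ _) (b≡ , _) (ff1 _ b≡′) _ _ = contradiction (trans b≡ b≡′) b≢

    cover-2 : ∀ {x y} → Dist x y 2 → Covered 1 (Geodesic x y 2)
    cover-2 δ = cover-unique (next-unique-2 δ) (λ _ → cover-1) δ

    -- There are two ways out of `f`: through its own point, if that lies on the line of `g`, or
    -- along its line to the point of `g`.
    next-3 : ∀ {f g z} → Dist (inj₂ f) (inj₂ g) 3 → Adjacent (inj₂ f) z → Dist z (inj₂ g) 2 →
      (z ≡ inj₁ (point f) × On (point f) (line g)) ⊎
      (∃[ h ] (z ≡ inj₂ h × point h ≡ point g × line h ≡ line f))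
    next-3 {z = inj₁ _} _ refl       (pf2 _ on) = inj₁ (refl , on)
    next-3 {z = inj₂ h} _ (b≡ , _) (ff2 _ p≡) = inj₂ (h , refl , p≡ , sym b≡)

    -- One of the two ways of `next-3` is closed. This and `cover-3-flag` make the tails of
    -- distance-4 geodesics unique, so that the three choices of the first step are not doubled.
    cover-3-point : ∀ {f g} → ¬ On (point g) (line f) → Dist (inj₂ f) (inj₂ g) 3 →
      Covered 1 (Geodesic (inj₂ f) (inj₂ g) 3)
    cover-3-point {f} {g} off δ = cover-unique uniq (λ _ → cover-2) δ
      where
      uniq : ∀ {z z′} → Adjacent (inj₂ f) z → Dist z (inj₂ g) 2 →
             Adjacent (inj₂ f) z′ → Dist z′ (inj₂ g) 2 → z′ ≡ z
      uniq a ε a′ ε′ with next-3 δ a ε | next-3 δ a′ ε′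
      ... | inj₁ (refl , _)          | inj₁ (refl , _)          = refl
      ... | inj₂ (h , _ , p≡ , b≡)   | _                        = contradiction (h , p≡ , b≡) off
      ... | inj₁ _                   | inj₂ (h , _ , p≡ , b≡)   = contradiction (h , p≡ , b≡) off

    cover-3-flag : ∀ {f g} → ¬ On (point f) (line g) → Dist (inj₂ f) (inj₂ g) 3 →
      Covered 1 (Geodesic (inj₂ f) (inj₂ g) 3)
    cover-3-flag {f} {g} off δ = cover-unique uniq (λ _ → cover-2) δ
      where
      uniq : ∀ {z z′} → Adjacent (inj₂ f) z → Dist z (inj₂ g) 2 →
             Adjacent (inj₂ f) z′ → Dist z′ (inj₂ g) 2 → z′ ≡ z
      uniq a ε a′ ε′ with next-3 δ a ε | next-3 δ a′ ε′
      ... | inj₂ (h , refl , p≡ , b≡) | inj₂ (h′ , refl , p≡′ , b≡′) =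
        cong inj₂ (flag-≡ (trans p≡′ (sym p≡)) (trans b≡′ (sym b≡)))
      ... | inj₁ (_ , on) | _            = contradiction on off
      ... | inj₂ _       | inj₁ (_ , on) = contradiction on off

    module _ (joins≤3 : ∀ {p q} → p ≢ q → Covered 3 (Joining p q))
             (meets≤3 : ∀ {b c} → b ≢ c → Covered 3 (Meeting b c)) where

      via-flags : ∀ {x y d} {P : Flag → Set} → Covered 3 P →
        (∀ {z} → Adjacent x z → Dist z y d → ∃[ f ] (z ≡ inj₂ f × P f)) →
        (∀ {z} → Adjacent x z → Dist z y d → Covered 1 (Geodesic z y d)) →
        Dist x y (suc d) → Covered 3 (Geodesic x y (suc d))
      via-flags (fs , le , f∈) next cov δ =
        let xs , le′ , g = cover-via (map inj₂ fs) (λ a ε → case next a ε of λ where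
              (f , refl , Pf) → ∈-map⁺ inj₂ (f∈ Pf)) cov δ
        in  xs , ≤-trans le′ (≤-trans (≤-reflexive (trans (*-identityʳ _) (length-map inj₂ fs))) le) , g

      ≤3 : ∀ {P : List Vertex → Set} → Covered 1 P → Covered 3 P
      ≤3 (xs , le , f) = xs , ≤-trans le (s≤s z≤n) , f

      cover-pp3 : ∀ {p q} → Dist (inj₁ p) (inj₁ q) 3 → Covered 3 (Geodesic (inj₁ p) (inj₁ q) 3)
      cover-pp3 {p} {q} δ@(pp3 p≢q) = via-flags (joins≤3 p≢q) next (λ _ → cover-2) δ
        where
        next : ∀ {z} → Adjacent (inj₁ p) z → Dist z (inj₁ q) 2 → ∃[ f ] (z ≡ inj₂ f × Joining p q f)
        next p≡ (fp2 _ on) = _ , refl , p≡ , on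

      cover : ∀ {x y d} → Dist x y d → Covered 3 (Geodesic x y d)
      cover pp0           = ≤3 cover-0
      cover δ@(pp3 _)     = cover-pp3 δ
      cover δ@(pf1 _)     = ≤3 (cover-1 δ)
      cover δ@(pf2 _ _)   = ≤3 (cover-2 δ)
      cover δ@(pf4 {p} {g} off) =
        via-flags (joins≤3 {p} {point g} (λ { refl → off (g , refl , refl) })) next tail δ
        where
        next : ∀ {z} → Adjacent (inj₁ p) z → Dist z (inj₂ g) 3 → ∃[ f ] (z ≡ inj₂ f × Joining p (point g) f)
        next {inj₂ f} refl (ff3 _ _ (inj₁ on)) = contradiction on off
        next {inj₂ f} refl (ff3 _ _ (inj₂ on)) = f , refl , refl , on
        tail : ∀ {z} → Adjacent (inj₁ p) z → Dist z (inj₂ g) 3 → Covered 1 (Geodesic z (inj₂ g) 3)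
        tail {inj₂ f} refl ε = cover-3-flag off ε
      cover δ@(fp1 _)     = ≤3 (cover-1 δ)
      cover δ@(fp2 _ _)   = ≤3 (cover-2 δ)
      -- No flag is at distance 3 from a point, so the first step must go to the point of `f`; the
      -- three choices come after it.
      cover δ@(fp4 {f} {q} off) = cover-unique uniq tail δ
        where
        uniq : ∀ {z z′} → Adjacent (inj₂ f) z → Dist z (inj₁ q) 3 →
               Adjacent (inj₂ f) z′ → Dist z′ (inj₁ q) 3 → z′ ≡ z
        uniq refl (pp3 _) refl (pp3 _) = refl
        tail : ∀ {z} → Adjacent (inj₂ f) z → Dist z (inj₁ q) 3 → Covered 3 (Geodesic z (inj₁ q) 3)
        tail _ (pp3 p≢q) = cover-pp3 (pp3 p≢q)
      cover ff0           = ≤3 cover-0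
      cover δ@(ff1 _ _)   = ≤3 (cover-1 δ)
      cover δ@(ff2 _ _)   = ≤3 (cover-2 δ)
      cover δ@(ff3 {f} {g} _ _ _) with on? (point g) (line f)
      ... | no off = ≤3 (cover-3-point off δ)
      ... | yes (h , p≡ , b≡) =
        -- Both ways of `next-3` can be open here, when each point lies on the other line; this
        -- gives at most two geodesics.
        let xs , le , F = cover-via (inj₁ (point f) ∷ inj₂ h ∷ []) mem (λ _ → cover-2) δ
        in  xs , ≤-trans le (s≤s (s≤s z≤n)) , F
        where
        mem : ∀ {z} → Adjacent (inj₂ f) z → Dist z (inj₂ g) 2 → z ∈ˡ inj₁ (point f) ∷ inj₂ h ∷ []
        mem a ε with next-3 δ a ε
        ... | inj₁ (refl , _) = here refl
        ... | inj₂ (h′ , refl , p≡′ , b≡′) = there (here (cong inj₂ (flag-≡ (trans p≡′ (sym p≡)) (trans b≡′ (sym b≡)))))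
      cover δ@(ff4 {f} {g} f∉ g∉) = via-flags (meets≤3 (λ b≡ → f∉ (f , refl , b≡))) next tail δ
        where
        next : ∀ {z} → Adjacent (inj₂ f) z → Dist z (inj₂ g) 3 → ∃[ h ] (z ≡ inj₂ h × Meeting (line f) (line g) h)
        next {inj₂ h} (b≡ , _) (ff3 _ _ (inj₁ on)) = h , refl , sym b≡ , on
        next {inj₂ h} (b≡ , _) (ff3 _ _ (inj₂ (i , p≡ , b≡′))) = contradiction (i , p≡ , trans b≡′ (sym b≡)) g∉
        tail : ∀ {z} → Adjacent (inj₂ f) z → Dist z (inj₂ g) 3 → Covered 1 (Geodesic z (inj₂ g) 3)
        tail {inj₂ h} (b≡ , _) ε = cover-3-point (λ { (i , p≡ , b≡′) → g∉ (i , p≡ , trans b≡′ (sym b≡)) }) ε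

length-filter-map : ∀ {A B : Set} {P : Pred B 0ℓ} (P? : Decidable P) (f : A → B) xs →
  length (filter P? (map f xs)) ≡ length (filter (P? ∘ f) xs)
length-filter-map P? f []       = refl
length-filter-map P? f (x ∷ xs) with does (P? (f x))
... | true  = cong suc (length-filter-map P? f xs)
... | false = length-filter-map P? f xs

-- Symmetric designs

open DecMembership ℕ._≟_ using () renaming (_∈?_ to _∈ˡ?_)

-- Row r of a table lists the points on line r, or dually the lines through point r.
-- A design is given by both tables; the dual intersection property is checked
-- rather than derived, which would need the inverse of the incidence matrix.
Table : ℕ → ℕ → Set
Table v k = Vec (Vec ℕ k) v

entry : Table v k → Fin v → Fin k → ℕ
entry t r = lookup (lookup t r)

row : Table v k → Fin v → List ℕ
row t r = tabulate (lookup (lookup t r))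

#shared : List ℕ → List ℕ → ℕ
#shared xs ys = length (filter (_∈ˡ? ys) xs)

-- Used for both tables: on the lines, `three` says that two lines share three points, on the dual,
-- that two points share three lines.
record IsTable (t : Table v k) : Set where
  field
    bounded  : ∀ r i → entry t r i < v
    distinct : ∀ r i j → entry t r i ≡ entry t r j → i ≡ j
    three    : ∀ r s → r ≡ s ⊎ #shared (row t r) (row t s) ≡ 3

  value : Fin v → Fin k → Fin v
  value r i = fromℕ< (bounded r i)

  toℕ-value : ∀ r i → toℕ (value r i) ≡ entry t r i
  toℕ-value r i = Fin.toℕ-fromℕ< (bounded r i)

  value-injective : ∀ {r i j} → value r i ≡ value r j → i ≡ j
  value-injective {r} {i} {j} eq = distinct r i j (trans (sym (toℕ-value r i)) (trans (cong toℕ eq) (toℕ-value r j)))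

  value∈row : ∀ {x r i} → value r i ≡ x → toℕ x ∈ˡ row t r
  value∈row {r = r} {i} refl = subst (_∈ˡ row t r) (sym (toℕ-value r i)) (∈-tabulate⁺ i)

  row⇒value : ∀ {x r} → toℕ x ∈ˡ row t r → ∃[ i ] value r i ≡ x
  row⇒value x∈ with ∈-tabulate⁻ x∈
  ... | i , eq = i , Fin.toℕ-injective (trans (toℕ-value _ i) (sym eq))

  shared-3 : ∀ {r s} → r ≢ s → #shared (row t r) (row t s) ≡ 3
  shared-3 {r} {s} r≢s with three r s
  ... | inj₁ r≡s = contradiction r≡s r≢s
  ... | inj₂ eq  = eq

  some-shared : ∀ {r s} → r ≢ s → ∃[ i ] toℕ (value r i) ∈ˡ row t s
  some-shared {r} {s} r≢s with filter (_∈ˡ? row t s) (row t r) in eq | shared-3 r≢s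
  ... | x ∷ xs | _ with ∈-filter⁻ (_∈ˡ? row t s) {xs = row t r} (subst (x ∈ˡ_) (sym eq) (here refl))
  ... | x∈r , x∈s with ∈-tabulate⁻ x∈r
  ... | i , refl = i , subst (_∈ˡ row t s) (sym (toℕ-value r i)) x∈s

  all-shared : ∀ {r s} → r ≢ s → Covered 3 (λ i → toℕ (value r i) ∈ˡ row t s)
  all-shared {r} {s} r≢s = filter (λ i → entry t r i ∈ˡ? row t s) (allFin k) ,
    ≤-reflexive (begin
      length (filter ((_∈ˡ? row t s) ∘ entry t r) (allFin k)) ≡⟨ length-filter-map (_∈ˡ? row t s) (entry t r) (allFin k) ⟨
      length (filter (_∈ˡ? row t s) (map (entry t r) (allFin k))) ≡⟨ cong (λ xs → #shared xs (row t s)) (map-tabulate id (entry t r)) ⟩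
      #shared (row t r) (row t s)                              ≡⟨ shared-3 r≢s ⟩
      3                                                        ∎) ,
    λ {i} x∈ → ∈-filter⁺ (λ i → entry t r i ∈ˡ? row t s) (∈-allFin i) (subst (_∈ˡ row t s) (toℕ-value r i) x∈)
    where open ≡-Reasoning

isTable? : (t : Table v k) → Dec (IsTable t)
isTable? {v} t = map′
  (λ (b , d , s) → record { bounded = b ; distinct = d ; three = s })
  (λ T → let open IsTable T in bounded , distinct , three)
  (Fin.all? (λ r → Fin.all? λ i → entry t r i <? v) ×-dec
   Fin.all? (λ r → Fin.all? λ i → Fin.all? λ j → (entry t r i ℕ.≟ entry t r j) →-dec (i Fin.≟ j)) ×-dec
   Fin.all? (λ r → Fin.all? λ s → (r Fin.≟ s) ⊎-dec (#shared (row t r) (row t s) ℕ.≟ 3)))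

-- `dual` and `dual′` make the two tables present one incidence relation. `antiflag` yields a pair
-- at distance 4, which is also the nonadjacent pair behind the cut of size `k`.
record IsDesign (t t′ : Table v k) : Set where
  field
    lines  : IsTable t
    points : IsTable t′

  open IsTable lines  public using () renaming (value to pointOf)
  open IsTable points public using () renaming (value to lineOf)

  field
    dual     : ∀ b i → toℕ b ∈ˡ row t′ (pointOf b i)
    dual′    : ∀ p j → toℕ p ∈ˡ row t  (lineOf p j)
    antiflag : ∃[ p ] ∃[ b ] toℕ {v} p ∉ˡ row t b

isDesign? : (t t′ : Table v k) → Dec (IsDesign t t′)
isDesign? t t′ with isTable? t | isTable? t′
... | no ¬T | _     = no (¬T ∘ IsDesign.lines)
... | _     | no ¬T = no (¬T ∘ IsDesign.points)
... | yes T | yes T′ = map′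
  (λ (d , d′ , a) → record { lines = T ; points = T′ ; dual = d ; dual′ = d′ ; antiflag = a })
  -- The fields of `D` refer to its own table proofs instead of `T` and `T′`; the types agree
  -- because `fromℕ<` is irrelevant in its bound.
  (λ D → let open IsDesign D in dual , dual′ , antiflag)
  (Fin.all? (λ b → Fin.all? λ i → toℕ b ∈ˡ? row t′ (IsTable.value T b i)) ×-dec
   Fin.all? (λ p → Fin.all? λ j → toℕ p ∈ˡ? row t (IsTable.value T′ p j)) ×-dec
   Fin.any? (λ p → Fin.any? λ b → ¬? (toℕ p ∈ˡ? row t b)))

-- The flag graph of a design

module DesignGraph {v n : ℕ} {t t′ : Table v (suc n)} (D : IsDesign t t′) where
  open IsDesign D
  private
    module L = IsTable lines
    module P = IsTable points

  -- A flag is a line with a position in its row, so flags are finite by construction and `flag-≡`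
  -- is injectivity of rows.
  incidence : Incidence
  incidence = record
    { Point  = Fin v
    ; Line   = Fin v
    ; Flag   = Fin v × Fin (suc n)
    ; _≟ᴾ_   = Fin._≟_
    ; _≟ᴸ_   = Fin._≟_
    ; _≟ᶠ_   = ≡-dec Fin._≟_ Fin._≟_
    ; point  = λ (b , i) → pointOf b i
    ; line   = proj₁
    ; flag-≡ = λ { {b , i} {.b , j} p≡ refl → cong (b ,_) (L.value-injective p≡) }
    ; on?    = λ p b → map′ (λ (i , eq) → (b , i) , eq , refl) (λ { ((.b , i) , eq , refl) → i , eq })
        (Fin.any? λ i → pointOf b i Fin.≟ p)
    }

  open Incidence incidence
  open FlagGraph incidence

  on⇒∈row : ∀ {p b} → On p b → toℕ p ∈ˡ row t b
  on⇒∈row (_ , eq , refl) = L.value∈row eq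

  ∈row⇒on : ∀ {p b} → toℕ p ∈ˡ row t b → On p b
  ∈row⇒on {b = b} p∈ = let i , eq = L.row⇒value p∈ in (b , i) , eq , refl

  on⇒∈row′ : ∀ {p b} → On p b → toℕ b ∈ˡ row t′ p
  on⇒∈row′ ((b , i) , refl , refl) = dual b i

  ∈row′⇒on : ∀ {p b} → toℕ b ∈ˡ row t′ p → On p b
  ∈row′⇒on {p} b∈ with P.row⇒value b∈
  ... | j , refl = ∈row⇒on (dual′ p j)

  -- The flags at `p`, indexed by the dual row of `p`; `dual′` locates `p` in the row of each of
  -- these lines.
  pencil : Fin v → Fin (suc n) → Flag
  pencil p j = proj₁ (∈row⇒on (dual′ p j))

  point-pencil : ∀ p j → point (pencil p j) ≡ p
  point-pencil p j = proj₁ (proj₂ (∈row⇒on (dual′ p j)))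

  line-pencil : ∀ p j → line (pencil p j) ≡ lineOf p j
  line-pencil p j = proj₂ (proj₂ (∈row⇒on (dual′ p j)))

  pencil-injective : ∀ {p} → Injective _≡_ _≡_ (pencil p)
  pencil-injective {p} {i} {j} eq = P.value-injective
    (trans (sym (line-pencil p i)) (trans (cong line eq) (line-pencil p j)))

  pencil-complete : ∀ {p} f → point f ≡ p → ∃[ j ] (lineOf p j ≡ line f × pencil p j ≡ f)
  pencil-complete {p} f eq =
    let j , l≡ = P.row⇒value (on⇒∈row′ (f , eq , refl))
    in  j , l≡ , flag-≡ (trans (point-pencil p j) (sym eq)) (trans (line-pencil p j) l≡)

  joins : ∀ {p q} → p ≢ q → ∃ (Joining p q)
  joins {p} p≢q =
    let j , l∈ = P.some-shared p≢q
    in  pencil p j , point-pencil p j , subst (On _) (sym (line-pencil p j)) (∈row′⇒on l∈)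

  joins≤3 : ∀ {p q} → p ≢ q → Covered 3 (Joining p q)
  joins≤3 {p} {q} p≢q =
    let js , le , f = P.all-shared p≢q
    in  map (pencil p) js , ≤-trans (≤-reflexive (length-map (pencil p) js)) le , λ {g} (eq , on) →
          let j , l≡ , g≡ = pencil-complete g eq
          in  subst (_∈ˡ map (pencil p) js) g≡
                (∈-map⁺ (pencil p) (f (on⇒∈row′ (subst (On q) (sym l≡) on))))

  meets : ∀ {b c} → b ≢ c → ∃ (Meeting b c)
  meets {b} b≢c = let i , p∈ = L.some-shared b≢c in (b , i) , refl , ∈row⇒on p∈

  meets≤3 : ∀ {b c} → b ≢ c → Covered 3 (Meeting b c)
  meets≤3 {b} b≢c =
    let is , le , f = L.all-shared b≢c
    in  map (b ,_) is , ≤-trans (≤-reflexive (length-map (b ,_) is)) le ,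
          λ { {.b , i} (refl , on) → ∈-map⁺ (b ,_) (f (on⇒∈row on)) }

  N : ℕ
  N = v + v * suc n

  -- Abstract, so that unification can recover x from an application of from to x.
  abstract
    vertices : Fin N ↔ Vertex
    vertices = (↔-id (Fin v) ⊎-↔ Fin.*↔×) ↔-∘ Fin.+↔⊎

  open Pullback flagGraph vertices
  open Inverse vertices using (to; from; strictlyInverseˡ; strictlyInverseʳ)

  _≟ⱽ_ : (x y : Vertex) → Dec (x ≡ y)
  _≟ⱽ_ = Sum.≡-dec Fin._≟_ (≡-dec Fin._≟_ Fin._≟_)

  neighbours : Vertex → List Vertex
  neighbours (inj₁ p)       = tabulate (inj₂ ∘ pencil p)
  neighbours (inj₂ (b , i)) = inj₁ (pointOf b i) ∷ tabulate (λ j → inj₂ (b , punchIn i j))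

  length-neighbours : ∀ x → length (neighbours x) ≡ suc n
  length-neighbours (inj₁ p)       = length-tabulate (inj₂ ∘ pencil p)
  length-neighbours (inj₂ (b , i)) = cong suc (length-tabulate (λ j → inj₂ (b , punchIn i j)))

  unique-neighbours : ∀ x → Unique (neighbours x)
  unique-neighbours (inj₁ p)       = Unique.tabulate⁺ (pencil-injective ∘ inj₂-injective)
  unique-neighbours (inj₂ (b , i)) = All.tabulate⁺ (λ _ ()) ∷
    Unique.tabulate⁺ (Fin.punchIn-injective i _ _ ∘ cong proj₂ ∘ inj₂-injective)

  neighbours-complete : ∀ x {y} → Adjacent x y → y ∈ˡ neighbours x
  neighbours-complete (inj₁ p) {inj₂ g} eq =
    let j , _ , g≡ = pencil-complete g eq
    in  subst (λ g → inj₂ g ∈ˡ neighbours (inj₁ p)) g≡ (∈-tabulate⁺ {f = inj₂ ∘ pencil p} j)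
  neighbours-complete (inj₂ f)       {inj₁ q} refl = here refl
  neighbours-complete (inj₂ (b , i)) {inj₂ (.b , j)} (refl , f≢) =
    there (subst (λ j → inj₂ (b , j) ∈ˡ tabulate (λ j → inj₂ (b , punchIn i j))) (Fin.punchIn-punchOut i≢j)
      (∈-tabulate⁺ {f = λ j → inj₂ (b , punchIn i j)} (punchOut i≢j)))
    where
    i≢j : i ≢ j
    i≢j i≡j = f≢ (cong (b ,_) i≡j)

  neighbours-sound : ∀ x {y} → y ∈ˡ neighbours x → Adjacent x y
  neighbours-sound (inj₁ p) y∈ with ∈-tabulate⁻ {f = inj₂ ∘ pencil p} y∈
  ... | j , refl = point-pencil p j
  neighbours-sound (inj₂ (b , i)) (here refl) = refl
  neighbours-sound (inj₂ (b , i)) (there y∈) with ∈-tabulate⁻ {f = λ j → inj₂ (b , punchIn i j)} y∈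
  ... | j , refl = refl , λ eq → Fin.punchInᵢ≢i i j (sym (cong proj₂ eq))

  regular : Regular pullback (suc n)
  regular u = trans
    (count-≡ (Graph.adj? pullback u) (Unique.map⁺ from-injective (unique-neighbours (to u)))
      (λ {x} a → subst (_∈ˡ map from (neighbours (to u))) (strictlyInverseʳ x) (∈-map⁺ from (neighbours-complete (to u) a)))
      sound)
    (trans (length-map from (neighbours (to u))) (length-neighbours (to u)))
    where
    sound : ∀ {x} → x ∈ˡ map from (neighbours (to u)) → Adjacent (to u) (to x)
    sound x∈ with ∈-map⁻ from x∈
    ... | y , y∈ , refl = subst (Adjacent (to u)) (sym (strictlyInverseˡ y)) (neighbours-sound (to u) y∈)

  far : ∃[ p ] ∃[ g ] Dist (inj₁ p) (inj₂ g) 4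
  far = let p , b , p∉ = antiflag in p , (b , zero) , pf4 (p∉ ∘ on⇒∈row)

  -- Connectedness after deletion of fewer than `suc n` vertices

  module _ (S : Subset N) (small : ∣ S ∣ < suc n) where

    Alive : Vertex → Set
    Alive x = from x ∈ ∁ S

    _~_ : Vertex → Vertex → Set
    x ~ y = Adjacent x y × Alive x × Alive y

    ~-sym : ∀ {x y} → x ~ y → y ~ x
    ~-sym {x} {y} (a , ax , ay) = Graph.adj-sym flagGraph {x} {y} a , ay , ax

    untouched-class : (C : Fin (suc n) → Pred Vertex 0ℓ) → (∀ i → Decidable (C i)) →
      (∀ {i j x} → C i x → C j x → i ≡ j) → ∃[ i ] (∀ {x} → C i x → Alive x)
    untouched-class C C? disjoint =
      let i , alive = untouched S small (λ i → C i ∘ to) (λ i → C? i ∘ to) disjoint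
      in  i , λ {x} c → alive (from x) (subst (C i) (sym (strictlyInverseˡ x)) c)

    -- Sorts the vertices into disjoint stars, each a point with its flags; `Good` means that a
    -- whole star survives.
    centre : Vertex → Point
    centre (inj₁ p) = p
    centre (inj₂ f) = point f

    Good : Point → Set
    Good p = ∀ {x} → centre x ≡ p → Alive x

    -- The `suc n` points of a line have disjoint stars, more stars than deleted vertices.
    good-on-line : ∀ b → ∃[ i ] Good (pointOf b i)
    good-on-line b = untouched-class (λ i x → centre x ≡ pointOf b i) (λ i x → centre x Fin.≟ pointOf b i)
      (λ p≡ q≡ → L.value-injective (trans (sym p≡) q≡))

    flag-to-good : ∀ f → Alive (inj₂ f) → ∃[ p ] (Good p × Star _~_ (inj₂ f) (inj₁ p))
    flag-to-good f@(b , i) alive with good-on-line b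
    ... | j , good with i Fin.≟ j
    ... | yes refl = pointOf b i , good , (refl , alive , good refl) ◅ done
    -- The flags of `b` form a clique, and the flag at the good point survives with its star.
    ... | no i≢j   = pointOf b j , good ,
      (((refl , λ { refl → i≢j refl }) , alive , good refl) ◅ (refl , good {inj₂ (b , j)} refl , good refl) ◅ done)

    to-good : ∀ x → Alive x → ∃[ p ] (Good p × Star _~_ x (inj₁ p))
    to-good (inj₂ f) alive = flag-to-good f alive
    to-good (inj₁ p) alive =
      -- The classes are now single flags: `p` has `suc n` of them, so one survives.
      let j , alive′ = untouched-class (λ j x → x ≡ inj₂ (pencil p j)) (λ j x → x ≟ⱽ inj₂ (pencil p j))
            (λ { refl eq → pencil-injective (inj₂-injective eq) })
          q , good , r = flag-to-good (pencil p j) (alive′ refl)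
      in  q , good , (point-pencil p j , alive , alive′ refl) ◅ r

    -- The route crosses a joining line by its flags at `p` and `q`, which lie in the two surviving
    -- stars.
    good-to-good : ∀ {p q} → Good p → Good q → Star _~_ (inj₁ p) (inj₁ q)
    good-to-good {p} {q} gp gq with p Fin.≟ q
    ... | yes refl = done
    ... | no p≢q with joins p≢q
    ... | f , refl , h , refl , l≡ =
      (refl , gp refl , gp {inj₂ f} refl) ◅
      ((sym l≡ , λ { refl → p≢q refl }) , gp refl , gq {inj₂ h} refl) ◅
      (refl , gq refl , gq refl) ◅ done

    all-reachable : ∀ x y → Alive x → Alive y → Star _~_ x y
    all-reachable x y ax ay =
      let p , gp , r = to-good x ax
          q , gq , s = to-good y ay
      in  r ◅◅ good-to-good gp gq ◅◅ reverse ~-sym s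

    -- Equations tie the endpoints to the chain, because a vertex of the deleted graph also carries
    -- a membership proof; uniqueness of these proofs closes the base case.
    lift : ∀ {x y u w u∈ w∈} → Star _~_ x y → to u ≡ x → to w ≡ y →
      Star (Graph.Adj (delete pullback S)) (u , u∈) (w , w∈)
    lift {u = u} {w} {u∈} {w∈} done refl w≡ with to-injective {w} {u} w≡
    ... | refl rewrite []=-irrelevant u∈ w∈ = done
    lift {u = u} (_◅_ {j = y} (a , _ , ay) r) refl w≡ =
      _◅_ {j = from y , ay} (subst (Adjacent (to u)) (sym (strictlyInverseˡ y)) a) (lift r (strictlyInverseˡ y) w≡)

    reachable : ∀ x y → Star (Graph.Adj (delete pullback S)) x y
    reachable (u , u∈) (w , w∈) = lift (all-reachable (to u) (to w) (alive u∈) (alive w∈)) refl refl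
      where
      alive : ∀ {u} → u ∈ ∁ S → Alive (to u)
      alive {u} u∈ = subst (_∈ ∁ S) (sym (strictlyInverseʳ u)) u∈

  connectivity : HasVertexConnectivity pullback (suc n)
  connectivity =
    let p , (g@(b , i)) , δ = far
    in hasVertexConnectivity pullback {u = from (inj₁ p)} {v = from (inj₂ g)} regular
         (λ eq → case from-injective eq of λ ())
         (λ a → apart δ (subst₂ Adjacent (strictlyInverseˡ (inj₁ p)) (strictlyInverseˡ (inj₂ g)) a))
         reachable
    where
    apart : ∀ {p g} → Dist (inj₁ p) (inj₂ g) 4 → ¬ Adjacent (inj₁ p) (inj₂ g)
    apart {g = g} (pf4 ∉) eq = ∉ (g , eq , refl)

  diameter : HasDiameter pullback 4
  diameter = pullback-diameter (Metric.hasDiameter (metric joins meets) _≟ⱽ_ dist≤4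
    (let p , g , δ = far in inj₁ p , inj₂ g , δ))

  trigeodetic : Trigeodetic pullback
  trigeodetic = pullback-trigeodetic (Metric.trigeodetic (metric joins meets) _≟ⱽ_ (cover joins meets joins≤3 meets≤3))

  regular-block : 1 ≤ n → ∃[ N ] Σ[ G ∈ Graph (Fin N) ]
    (Regular G (suc n) × HasVertexConnectivity G (suc n) × Trigeodetic G × Block G × HasDiameter G 4)
  regular-block 1≤n = N , pullback , regular , connectivity , trigeodetic , (suc n , s≤s 1≤n , connectivity) , diameter

-- The designs

-- For a cyclic difference set D, the r-th line is D − r; since x lies on it
-- exactly when x + r ∈ D, the table is its own dual.
developed : ∀ v .{{_ : NonZero v}} → Vec ℕ k → Table v k
developed v D = Vec.tabulate λ r → Vec.map (λ d → (d + (v ∸ toℕ r)) % v) D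

-- The trivial design: all 4-subsets of five points.
lines-5 : Table 5 4
lines-5 = developed 5 (1 ∷ 2 ∷ 3 ∷ 4 ∷ [])

design-5 : IsDesign lines-5 lines-5
design-5 = from-yes (isDesign? lines-5 lines-5)

-- The complement of the nonzero squares modulo 11, hence of the Paley biplane.
lines-11 : Table 11 6
lines-11 = developed 11 (0 ∷ 2 ∷ 6 ∷ 7 ∷ 8 ∷ 10 ∷ [])

design-11 : IsDesign lines-11 lines-11
design-11 = from-yes (isDesign? lines-11 lines-11)

-- A Singer difference set: the exponents i with α^i of trace zero in the field of 16 elements,
-- where α⁴ = α + 1. The lines are the planes of PG(3, 2).
lines-15 : Table 15 7
lines-15 = developed 15 (0 ∷ 1 ∷ 2 ∷ 4 ∷ 5 ∷ 8 ∷ 10 ∷ [])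

design-15 : IsDesign lines-15 lines-15
design-15 = from-yes (isDesign? lines-15 lines-15)

-- McFarland's difference set in ℤ₅ × ℤ₃²: the i-th of the four lines through 0
-- in ℤ₃², placed over i ∈ ℤ₅, for i = 0, …, 3.  The element (c, a, b) of
-- ℤ₅ × ℤ₃ × ℤ₃ has number 9c + 3a + b, and lines are translates −r + D.
lines-45 : Table 45 12
lines-45 =
  (0 ∷ 1 ∷ 2 ∷ 9 ∷ 12 ∷ 15 ∷ 18 ∷ 22 ∷ 26 ∷ 27 ∷ 32 ∷ 34 ∷ []) ∷
  (0 ∷ 1 ∷ 2 ∷ 11 ∷ 14 ∷ 17 ∷ 20 ∷ 21 ∷ 25 ∷ 29 ∷ 31 ∷ 33 ∷ []) ∷
  (0 ∷ 1 ∷ 2 ∷ 10 ∷ 13 ∷ 16 ∷ 19 ∷ 23 ∷ 24 ∷ 28 ∷ 30 ∷ 35 ∷ []) ∷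
  (6 ∷ 7 ∷ 8 ∷ 9 ∷ 12 ∷ 15 ∷ 19 ∷ 23 ∷ 24 ∷ 29 ∷ 31 ∷ 33 ∷ []) ∷
  (6 ∷ 7 ∷ 8 ∷ 11 ∷ 14 ∷ 17 ∷ 18 ∷ 22 ∷ 26 ∷ 28 ∷ 30 ∷ 35 ∷ []) ∷
  (6 ∷ 7 ∷ 8 ∷ 10 ∷ 13 ∷ 16 ∷ 20 ∷ 21 ∷ 25 ∷ 27 ∷ 32 ∷ 34 ∷ []) ∷
  (3 ∷ 4 ∷ 5 ∷ 9 ∷ 12 ∷ 15 ∷ 20 ∷ 21 ∷ 25 ∷ 28 ∷ 30 ∷ 35 ∷ []) ∷
  (3 ∷ 4 ∷ 5 ∷ 11 ∷ 14 ∷ 17 ∷ 19 ∷ 23 ∷ 24 ∷ 27 ∷ 32 ∷ 34 ∷ []) ∷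
  (3 ∷ 4 ∷ 5 ∷ 10 ∷ 13 ∷ 16 ∷ 18 ∷ 22 ∷ 26 ∷ 29 ∷ 31 ∷ 33 ∷ []) ∷
  (0 ∷ 3 ∷ 6 ∷ 9 ∷ 13 ∷ 17 ∷ 18 ∷ 23 ∷ 25 ∷ 36 ∷ 37 ∷ 38 ∷ []) ∷
  (2 ∷ 5 ∷ 8 ∷ 11 ∷ 12 ∷ 16 ∷ 20 ∷ 22 ∷ 24 ∷ 36 ∷ 37 ∷ 38 ∷ []) ∷
  (1 ∷ 4 ∷ 7 ∷ 10 ∷ 14 ∷ 15 ∷ 19 ∷ 21 ∷ 26 ∷ 36 ∷ 37 ∷ 38 ∷ []) ∷
  (0 ∷ 3 ∷ 6 ∷ 10 ∷ 14 ∷ 15 ∷ 20 ∷ 22 ∷ 24 ∷ 42 ∷ 43 ∷ 44 ∷ []) ∷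
  (2 ∷ 5 ∷ 8 ∷ 9 ∷ 13 ∷ 17 ∷ 19 ∷ 21 ∷ 26 ∷ 42 ∷ 43 ∷ 44 ∷ []) ∷
  (1 ∷ 4 ∷ 7 ∷ 11 ∷ 12 ∷ 16 ∷ 18 ∷ 23 ∷ 25 ∷ 42 ∷ 43 ∷ 44 ∷ []) ∷
  (0 ∷ 3 ∷ 6 ∷ 11 ∷ 12 ∷ 16 ∷ 19 ∷ 21 ∷ 26 ∷ 39 ∷ 40 ∷ 41 ∷ []) ∷
  (2 ∷ 5 ∷ 8 ∷ 10 ∷ 14 ∷ 15 ∷ 18 ∷ 23 ∷ 25 ∷ 39 ∷ 40 ∷ 41 ∷ []) ∷
  (1 ∷ 4 ∷ 7 ∷ 9 ∷ 13 ∷ 17 ∷ 20 ∷ 22 ∷ 24 ∷ 39 ∷ 40 ∷ 41 ∷ []) ∷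
  (0 ∷ 4 ∷ 8 ∷ 9 ∷ 14 ∷ 16 ∷ 27 ∷ 28 ∷ 29 ∷ 36 ∷ 39 ∷ 42 ∷ []) ∷
  (2 ∷ 3 ∷ 7 ∷ 11 ∷ 13 ∷ 15 ∷ 27 ∷ 28 ∷ 29 ∷ 38 ∷ 41 ∷ 44 ∷ []) ∷
  (1 ∷ 5 ∷ 6 ∷ 10 ∷ 12 ∷ 17 ∷ 27 ∷ 28 ∷ 29 ∷ 37 ∷ 40 ∷ 43 ∷ []) ∷
  (1 ∷ 5 ∷ 6 ∷ 11 ∷ 13 ∷ 15 ∷ 33 ∷ 34 ∷ 35 ∷ 36 ∷ 39 ∷ 42 ∷ []) ∷
  (0 ∷ 4 ∷ 8 ∷ 10 ∷ 12 ∷ 17 ∷ 33 ∷ 34 ∷ 35 ∷ 38 ∷ 41 ∷ 44 ∷ []) ∷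
  (2 ∷ 3 ∷ 7 ∷ 9 ∷ 14 ∷ 16 ∷ 33 ∷ 34 ∷ 35 ∷ 37 ∷ 40 ∷ 43 ∷ []) ∷
  (2 ∷ 3 ∷ 7 ∷ 10 ∷ 12 ∷ 17 ∷ 30 ∷ 31 ∷ 32 ∷ 36 ∷ 39 ∷ 42 ∷ []) ∷
  (1 ∷ 5 ∷ 6 ∷ 9 ∷ 14 ∷ 16 ∷ 30 ∷ 31 ∷ 32 ∷ 38 ∷ 41 ∷ 44 ∷ []) ∷
  (0 ∷ 4 ∷ 8 ∷ 11 ∷ 13 ∷ 15 ∷ 30 ∷ 31 ∷ 32 ∷ 37 ∷ 40 ∷ 43 ∷ []) ∷
  (0 ∷ 5 ∷ 7 ∷ 18 ∷ 19 ∷ 20 ∷ 27 ∷ 30 ∷ 33 ∷ 36 ∷ 40 ∷ 44 ∷ []) ∷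
  (2 ∷ 4 ∷ 6 ∷ 18 ∷ 19 ∷ 20 ∷ 29 ∷ 32 ∷ 35 ∷ 38 ∷ 39 ∷ 43 ∷ []) ∷
  (1 ∷ 3 ∷ 8 ∷ 18 ∷ 19 ∷ 20 ∷ 28 ∷ 31 ∷ 34 ∷ 37 ∷ 41 ∷ 42 ∷ []) ∷
  (2 ∷ 4 ∷ 6 ∷ 24 ∷ 25 ∷ 26 ∷ 27 ∷ 30 ∷ 33 ∷ 37 ∷ 41 ∷ 42 ∷ []) ∷
  (1 ∷ 3 ∷ 8 ∷ 24 ∷ 25 ∷ 26 ∷ 29 ∷ 32 ∷ 35 ∷ 36 ∷ 40 ∷ 44 ∷ []) ∷
  (0 ∷ 5 ∷ 7 ∷ 24 ∷ 25 ∷ 26 ∷ 28 ∷ 31 ∷ 34 ∷ 38 ∷ 39 ∷ 43 ∷ []) ∷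
  (1 ∷ 3 ∷ 8 ∷ 21 ∷ 22 ∷ 23 ∷ 27 ∷ 30 ∷ 33 ∷ 38 ∷ 39 ∷ 43 ∷ []) ∷
  (0 ∷ 5 ∷ 7 ∷ 21 ∷ 22 ∷ 23 ∷ 29 ∷ 32 ∷ 35 ∷ 37 ∷ 41 ∷ 42 ∷ []) ∷
  (2 ∷ 4 ∷ 6 ∷ 21 ∷ 22 ∷ 23 ∷ 28 ∷ 31 ∷ 34 ∷ 36 ∷ 40 ∷ 44 ∷ []) ∷
  (9 ∷ 10 ∷ 11 ∷ 18 ∷ 21 ∷ 24 ∷ 27 ∷ 31 ∷ 35 ∷ 36 ∷ 41 ∷ 43 ∷ []) ∷
  (9 ∷ 10 ∷ 11 ∷ 20 ∷ 23 ∷ 26 ∷ 29 ∷ 30 ∷ 34 ∷ 38 ∷ 40 ∷ 42 ∷ []) ∷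
  (9 ∷ 10 ∷ 11 ∷ 19 ∷ 22 ∷ 25 ∷ 28 ∷ 32 ∷ 33 ∷ 37 ∷ 39 ∷ 44 ∷ []) ∷
  (15 ∷ 16 ∷ 17 ∷ 18 ∷ 21 ∷ 24 ∷ 28 ∷ 32 ∷ 33 ∷ 38 ∷ 40 ∷ 42 ∷ []) ∷
  (15 ∷ 16 ∷ 17 ∷ 20 ∷ 23 ∷ 26 ∷ 27 ∷ 31 ∷ 35 ∷ 37 ∷ 39 ∷ 44 ∷ []) ∷
  (15 ∷ 16 ∷ 17 ∷ 19 ∷ 22 ∷ 25 ∷ 29 ∷ 30 ∷ 34 ∷ 36 ∷ 41 ∷ 43 ∷ []) ∷
  (12 ∷ 13 ∷ 14 ∷ 18 ∷ 21 ∷ 24 ∷ 29 ∷ 30 ∷ 34 ∷ 37 ∷ 39 ∷ 44 ∷ []) ∷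
  (12 ∷ 13 ∷ 14 ∷ 20 ∷ 23 ∷ 26 ∷ 28 ∷ 32 ∷ 33 ∷ 36 ∷ 41 ∷ 43 ∷ []) ∷
  (12 ∷ 13 ∷ 14 ∷ 19 ∷ 22 ∷ 25 ∷ 27 ∷ 31 ∷ 35 ∷ 38 ∷ 40 ∷ 42 ∷ []) ∷
  []

-- The table is its own dual as in the cyclic case: incidence of x with line r means x + r ∈ D,
-- which is symmetric.
design-45 : IsDesign lines-45 lines-45
design-45 = from-yes (isDesign? lines-45 lines-45)

-- Invariant under the alternating group A₄, with orbits of length 12, 4, 3, 3, 3
-- on the points.
lines-25 : Table 25 9
lines-25 =
  (0 ∷ 1 ∷ 2 ∷ 9 ∷ 10 ∷ 11 ∷ 16 ∷ 19 ∷ 22 ∷ []) ∷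
  (0 ∷ 1 ∷ 2 ∷ 3 ∷ 4 ∷ 5 ∷ 17 ∷ 20 ∷ 23 ∷ []) ∷
  (0 ∷ 1 ∷ 2 ∷ 6 ∷ 7 ∷ 8 ∷ 18 ∷ 21 ∷ 24 ∷ []) ∷
  (3 ∷ 4 ∷ 5 ∷ 6 ∷ 7 ∷ 8 ∷ 16 ∷ 19 ∷ 22 ∷ []) ∷
  (3 ∷ 4 ∷ 5 ∷ 9 ∷ 10 ∷ 11 ∷ 18 ∷ 21 ∷ 24 ∷ []) ∷
  (6 ∷ 7 ∷ 8 ∷ 9 ∷ 10 ∷ 11 ∷ 17 ∷ 20 ∷ 23 ∷ []) ∷
  (0 ∷ 4 ∷ 7 ∷ 11 ∷ 12 ∷ 15 ∷ 16 ∷ 17 ∷ 21 ∷ []) ∷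
  (1 ∷ 5 ∷ 8 ∷ 11 ∷ 12 ∷ 13 ∷ 17 ∷ 18 ∷ 19 ∷ []) ∷
  (2 ∷ 5 ∷ 7 ∷ 10 ∷ 12 ∷ 14 ∷ 16 ∷ 18 ∷ 20 ∷ []) ∷
  (2 ∷ 3 ∷ 8 ∷ 9 ∷ 13 ∷ 14 ∷ 16 ∷ 17 ∷ 21 ∷ []) ∷
  (1 ∷ 4 ∷ 6 ∷ 9 ∷ 13 ∷ 15 ∷ 16 ∷ 18 ∷ 20 ∷ []) ∷
  (0 ∷ 3 ∷ 6 ∷ 10 ∷ 14 ∷ 15 ∷ 17 ∷ 18 ∷ 19 ∷ []) ∷
  (0 ∷ 5 ∷ 6 ∷ 11 ∷ 13 ∷ 14 ∷ 16 ∷ 23 ∷ 24 ∷ []) ∷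
  (1 ∷ 5 ∷ 7 ∷ 9 ∷ 14 ∷ 15 ∷ 17 ∷ 22 ∷ 24 ∷ []) ∷
  (2 ∷ 3 ∷ 7 ∷ 11 ∷ 13 ∷ 15 ∷ 18 ∷ 22 ∷ 23 ∷ []) ∷
  (1 ∷ 3 ∷ 8 ∷ 10 ∷ 12 ∷ 15 ∷ 16 ∷ 23 ∷ 24 ∷ []) ∷
  (0 ∷ 4 ∷ 8 ∷ 9 ∷ 12 ∷ 14 ∷ 18 ∷ 22 ∷ 23 ∷ []) ∷
  (2 ∷ 4 ∷ 6 ∷ 10 ∷ 12 ∷ 13 ∷ 17 ∷ 22 ∷ 24 ∷ []) ∷
  (1 ∷ 4 ∷ 7 ∷ 10 ∷ 13 ∷ 14 ∷ 19 ∷ 21 ∷ 23 ∷ []) ∷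
  (2 ∷ 4 ∷ 8 ∷ 11 ∷ 14 ∷ 15 ∷ 19 ∷ 20 ∷ 24 ∷ []) ∷
  (0 ∷ 5 ∷ 8 ∷ 10 ∷ 13 ∷ 15 ∷ 20 ∷ 21 ∷ 22 ∷ []) ∷
  (2 ∷ 5 ∷ 6 ∷ 9 ∷ 12 ∷ 15 ∷ 19 ∷ 21 ∷ 23 ∷ []) ∷
  (1 ∷ 3 ∷ 6 ∷ 11 ∷ 12 ∷ 14 ∷ 20 ∷ 21 ∷ 22 ∷ []) ∷
  (0 ∷ 3 ∷ 7 ∷ 9 ∷ 12 ∷ 13 ∷ 19 ∷ 20 ∷ 24 ∷ []) ∷
  (16 ∷ 17 ∷ 18 ∷ 19 ∷ 20 ∷ 21 ∷ 22 ∷ 23 ∷ 24 ∷ []) ∷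
  []

points-25 : Table 25 9
points-25 =
  (0 ∷ 1 ∷ 2 ∷ 6 ∷ 11 ∷ 12 ∷ 16 ∷ 20 ∷ 23 ∷ []) ∷
  (0 ∷ 1 ∷ 2 ∷ 7 ∷ 10 ∷ 13 ∷ 15 ∷ 18 ∷ 22 ∷ []) ∷
  (0 ∷ 1 ∷ 2 ∷ 8 ∷ 9 ∷ 14 ∷ 17 ∷ 19 ∷ 21 ∷ []) ∷
  (1 ∷ 3 ∷ 4 ∷ 9 ∷ 11 ∷ 14 ∷ 15 ∷ 22 ∷ 23 ∷ []) ∷
  (1 ∷ 3 ∷ 4 ∷ 6 ∷ 10 ∷ 16 ∷ 17 ∷ 18 ∷ 19 ∷ []) ∷
  (1 ∷ 3 ∷ 4 ∷ 7 ∷ 8 ∷ 12 ∷ 13 ∷ 20 ∷ 21 ∷ []) ∷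
  (2 ∷ 3 ∷ 5 ∷ 10 ∷ 11 ∷ 12 ∷ 17 ∷ 21 ∷ 22 ∷ []) ∷
  (2 ∷ 3 ∷ 5 ∷ 6 ∷ 8 ∷ 13 ∷ 14 ∷ 18 ∷ 23 ∷ []) ∷
  (2 ∷ 3 ∷ 5 ∷ 7 ∷ 9 ∷ 15 ∷ 16 ∷ 19 ∷ 20 ∷ []) ∷
  (0 ∷ 4 ∷ 5 ∷ 9 ∷ 10 ∷ 13 ∷ 16 ∷ 21 ∷ 23 ∷ []) ∷
  (0 ∷ 4 ∷ 5 ∷ 8 ∷ 11 ∷ 15 ∷ 17 ∷ 18 ∷ 20 ∷ []) ∷
  (0 ∷ 4 ∷ 5 ∷ 6 ∷ 7 ∷ 12 ∷ 14 ∷ 19 ∷ 22 ∷ []) ∷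
  (6 ∷ 7 ∷ 8 ∷ 15 ∷ 16 ∷ 17 ∷ 21 ∷ 22 ∷ 23 ∷ []) ∷
  (7 ∷ 9 ∷ 10 ∷ 12 ∷ 14 ∷ 17 ∷ 18 ∷ 20 ∷ 23 ∷ []) ∷
  (8 ∷ 9 ∷ 11 ∷ 12 ∷ 13 ∷ 16 ∷ 18 ∷ 19 ∷ 22 ∷ []) ∷
  (6 ∷ 10 ∷ 11 ∷ 13 ∷ 14 ∷ 15 ∷ 19 ∷ 20 ∷ 21 ∷ []) ∷
  (0 ∷ 3 ∷ 6 ∷ 8 ∷ 9 ∷ 10 ∷ 12 ∷ 15 ∷ 24 ∷ []) ∷
  (1 ∷ 5 ∷ 6 ∷ 7 ∷ 9 ∷ 11 ∷ 13 ∷ 17 ∷ 24 ∷ []) ∷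
  (2 ∷ 4 ∷ 7 ∷ 8 ∷ 10 ∷ 11 ∷ 14 ∷ 16 ∷ 24 ∷ []) ∷
  (0 ∷ 3 ∷ 7 ∷ 11 ∷ 18 ∷ 19 ∷ 21 ∷ 23 ∷ 24 ∷ []) ∷
  (1 ∷ 5 ∷ 8 ∷ 10 ∷ 19 ∷ 20 ∷ 22 ∷ 23 ∷ 24 ∷ []) ∷
  (2 ∷ 4 ∷ 6 ∷ 9 ∷ 18 ∷ 20 ∷ 21 ∷ 22 ∷ 24 ∷ []) ∷
  (0 ∷ 3 ∷ 13 ∷ 14 ∷ 16 ∷ 17 ∷ 20 ∷ 22 ∷ 24 ∷ []) ∷
  (1 ∷ 5 ∷ 12 ∷ 14 ∷ 15 ∷ 16 ∷ 18 ∷ 21 ∷ 24 ∷ []) ∷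
  (2 ∷ 4 ∷ 12 ∷ 13 ∷ 15 ∷ 17 ∷ 19 ∷ 23 ∷ 24 ∷ []) ∷
  []

design-25 : IsDesign lines-25 points-25
design-25 = from-yes (isDesign? lines-25 points-25)

-- Invariant under ℤ₇ acting with four orbits of length 7 and the fixed points
-- 28, 29, 30; the last 28 lines form four orbits.
lines-31 : Table 31 10
lines-31 =
  (0 ∷ 1 ∷ 2 ∷ 3 ∷ 4 ∷ 5 ∷ 6 ∷ 28 ∷ 29 ∷ 30 ∷ []) ∷
  (7 ∷ 8 ∷ 9 ∷ 10 ∷ 11 ∷ 12 ∷ 13 ∷ 28 ∷ 29 ∷ 30 ∷ []) ∷
  (14 ∷ 15 ∷ 16 ∷ 17 ∷ 18 ∷ 19 ∷ 20 ∷ 28 ∷ 29 ∷ 30 ∷ []) ∷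
  (0 ∷ 1 ∷ 7 ∷ 8 ∷ 14 ∷ 17 ∷ 21 ∷ 23 ∷ 25 ∷ 28 ∷ []) ∷
  (1 ∷ 2 ∷ 8 ∷ 9 ∷ 15 ∷ 18 ∷ 22 ∷ 24 ∷ 26 ∷ 28 ∷ []) ∷
  (2 ∷ 3 ∷ 9 ∷ 10 ∷ 16 ∷ 19 ∷ 23 ∷ 25 ∷ 27 ∷ 28 ∷ []) ∷
  (3 ∷ 4 ∷ 10 ∷ 11 ∷ 17 ∷ 20 ∷ 21 ∷ 24 ∷ 26 ∷ 28 ∷ []) ∷
  (4 ∷ 5 ∷ 11 ∷ 12 ∷ 14 ∷ 18 ∷ 22 ∷ 25 ∷ 27 ∷ 28 ∷ []) ∷
  (5 ∷ 6 ∷ 12 ∷ 13 ∷ 15 ∷ 19 ∷ 21 ∷ 23 ∷ 26 ∷ 28 ∷ []) ∷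
  (0 ∷ 6 ∷ 7 ∷ 13 ∷ 16 ∷ 20 ∷ 22 ∷ 24 ∷ 27 ∷ 28 ∷ []) ∷
  (0 ∷ 3 ∷ 9 ∷ 12 ∷ 18 ∷ 20 ∷ 21 ∷ 22 ∷ 23 ∷ 29 ∷ []) ∷
  (1 ∷ 4 ∷ 10 ∷ 13 ∷ 14 ∷ 19 ∷ 22 ∷ 23 ∷ 24 ∷ 29 ∷ []) ∷
  (2 ∷ 5 ∷ 7 ∷ 11 ∷ 15 ∷ 20 ∷ 23 ∷ 24 ∷ 25 ∷ 29 ∷ []) ∷
  (3 ∷ 6 ∷ 8 ∷ 12 ∷ 14 ∷ 16 ∷ 24 ∷ 25 ∷ 26 ∷ 29 ∷ []) ∷
  (0 ∷ 4 ∷ 9 ∷ 13 ∷ 15 ∷ 17 ∷ 25 ∷ 26 ∷ 27 ∷ 29 ∷ []) ∷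
  (1 ∷ 5 ∷ 7 ∷ 10 ∷ 16 ∷ 18 ∷ 21 ∷ 26 ∷ 27 ∷ 29 ∷ []) ∷
  (2 ∷ 6 ∷ 8 ∷ 11 ∷ 17 ∷ 19 ∷ 21 ∷ 22 ∷ 27 ∷ 29 ∷ []) ∷
  (1 ∷ 3 ∷ 11 ∷ 13 ∷ 15 ∷ 16 ∷ 21 ∷ 22 ∷ 25 ∷ 30 ∷ []) ∷
  (2 ∷ 4 ∷ 7 ∷ 12 ∷ 16 ∷ 17 ∷ 22 ∷ 23 ∷ 26 ∷ 30 ∷ []) ∷
  (3 ∷ 5 ∷ 8 ∷ 13 ∷ 17 ∷ 18 ∷ 23 ∷ 24 ∷ 27 ∷ 30 ∷ []) ∷
  (4 ∷ 6 ∷ 7 ∷ 9 ∷ 18 ∷ 19 ∷ 21 ∷ 24 ∷ 25 ∷ 30 ∷ []) ∷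
  (0 ∷ 5 ∷ 8 ∷ 10 ∷ 19 ∷ 20 ∷ 22 ∷ 25 ∷ 26 ∷ 30 ∷ []) ∷
  (1 ∷ 6 ∷ 9 ∷ 11 ∷ 14 ∷ 20 ∷ 23 ∷ 26 ∷ 27 ∷ 30 ∷ []) ∷
  (0 ∷ 2 ∷ 10 ∷ 12 ∷ 14 ∷ 15 ∷ 21 ∷ 24 ∷ 27 ∷ 30 ∷ []) ∷
  (2 ∷ 4 ∷ 5 ∷ 8 ∷ 9 ∷ 13 ∷ 14 ∷ 16 ∷ 20 ∷ 21 ∷ []) ∷
  (3 ∷ 5 ∷ 6 ∷ 7 ∷ 9 ∷ 10 ∷ 14 ∷ 15 ∷ 17 ∷ 22 ∷ []) ∷
  (0 ∷ 4 ∷ 6 ∷ 8 ∷ 10 ∷ 11 ∷ 15 ∷ 16 ∷ 18 ∷ 23 ∷ []) ∷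
  (0 ∷ 1 ∷ 5 ∷ 9 ∷ 11 ∷ 12 ∷ 16 ∷ 17 ∷ 19 ∷ 24 ∷ []) ∷
  (1 ∷ 2 ∷ 6 ∷ 10 ∷ 12 ∷ 13 ∷ 17 ∷ 18 ∷ 20 ∷ 25 ∷ []) ∷
  (0 ∷ 2 ∷ 3 ∷ 7 ∷ 11 ∷ 13 ∷ 14 ∷ 18 ∷ 19 ∷ 26 ∷ []) ∷
  (1 ∷ 3 ∷ 4 ∷ 7 ∷ 8 ∷ 12 ∷ 15 ∷ 19 ∷ 20 ∷ 27 ∷ []) ∷
  []

points-31 : Table 31 10
points-31 =
  (0 ∷ 3 ∷ 9 ∷ 10 ∷ 14 ∷ 21 ∷ 23 ∷ 26 ∷ 27 ∷ 29 ∷ []) ∷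
  (0 ∷ 3 ∷ 4 ∷ 11 ∷ 15 ∷ 17 ∷ 22 ∷ 27 ∷ 28 ∷ 30 ∷ []) ∷
  (0 ∷ 4 ∷ 5 ∷ 12 ∷ 16 ∷ 18 ∷ 23 ∷ 24 ∷ 28 ∷ 29 ∷ []) ∷
  (0 ∷ 5 ∷ 6 ∷ 10 ∷ 13 ∷ 17 ∷ 19 ∷ 25 ∷ 29 ∷ 30 ∷ []) ∷
  (0 ∷ 6 ∷ 7 ∷ 11 ∷ 14 ∷ 18 ∷ 20 ∷ 24 ∷ 26 ∷ 30 ∷ []) ∷
  (0 ∷ 7 ∷ 8 ∷ 12 ∷ 15 ∷ 19 ∷ 21 ∷ 24 ∷ 25 ∷ 27 ∷ []) ∷
  (0 ∷ 8 ∷ 9 ∷ 13 ∷ 16 ∷ 20 ∷ 22 ∷ 25 ∷ 26 ∷ 28 ∷ []) ∷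
  (1 ∷ 3 ∷ 9 ∷ 12 ∷ 15 ∷ 18 ∷ 20 ∷ 25 ∷ 29 ∷ 30 ∷ []) ∷
  (1 ∷ 3 ∷ 4 ∷ 13 ∷ 16 ∷ 19 ∷ 21 ∷ 24 ∷ 26 ∷ 30 ∷ []) ∷
  (1 ∷ 4 ∷ 5 ∷ 10 ∷ 14 ∷ 20 ∷ 22 ∷ 24 ∷ 25 ∷ 27 ∷ []) ∷
  (1 ∷ 5 ∷ 6 ∷ 11 ∷ 15 ∷ 21 ∷ 23 ∷ 25 ∷ 26 ∷ 28 ∷ []) ∷
  (1 ∷ 6 ∷ 7 ∷ 12 ∷ 16 ∷ 17 ∷ 22 ∷ 26 ∷ 27 ∷ 29 ∷ []) ∷
  (1 ∷ 7 ∷ 8 ∷ 10 ∷ 13 ∷ 18 ∷ 23 ∷ 27 ∷ 28 ∷ 30 ∷ []) ∷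
  (1 ∷ 8 ∷ 9 ∷ 11 ∷ 14 ∷ 17 ∷ 19 ∷ 24 ∷ 28 ∷ 29 ∷ []) ∷
  (2 ∷ 3 ∷ 7 ∷ 11 ∷ 13 ∷ 22 ∷ 23 ∷ 24 ∷ 25 ∷ 29 ∷ []) ∷
  (2 ∷ 4 ∷ 8 ∷ 12 ∷ 14 ∷ 17 ∷ 23 ∷ 25 ∷ 26 ∷ 30 ∷ []) ∷
  (2 ∷ 5 ∷ 9 ∷ 13 ∷ 15 ∷ 17 ∷ 18 ∷ 24 ∷ 26 ∷ 27 ∷ []) ∷
  (2 ∷ 3 ∷ 6 ∷ 14 ∷ 16 ∷ 18 ∷ 19 ∷ 25 ∷ 27 ∷ 28 ∷ []) ∷
  (2 ∷ 4 ∷ 7 ∷ 10 ∷ 15 ∷ 19 ∷ 20 ∷ 26 ∷ 28 ∷ 29 ∷ []) ∷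
  (2 ∷ 5 ∷ 8 ∷ 11 ∷ 16 ∷ 20 ∷ 21 ∷ 27 ∷ 29 ∷ 30 ∷ []) ∷
  (2 ∷ 6 ∷ 9 ∷ 10 ∷ 12 ∷ 21 ∷ 22 ∷ 24 ∷ 28 ∷ 30 ∷ []) ∷
  (3 ∷ 6 ∷ 8 ∷ 10 ∷ 15 ∷ 16 ∷ 17 ∷ 20 ∷ 23 ∷ 24 ∷ []) ∷
  (4 ∷ 7 ∷ 9 ∷ 10 ∷ 11 ∷ 16 ∷ 17 ∷ 18 ∷ 21 ∷ 25 ∷ []) ∷
  (3 ∷ 5 ∷ 8 ∷ 10 ∷ 11 ∷ 12 ∷ 18 ∷ 19 ∷ 22 ∷ 26 ∷ []) ∷
  (4 ∷ 6 ∷ 9 ∷ 11 ∷ 12 ∷ 13 ∷ 19 ∷ 20 ∷ 23 ∷ 27 ∷ []) ∷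
  (3 ∷ 5 ∷ 7 ∷ 12 ∷ 13 ∷ 14 ∷ 17 ∷ 20 ∷ 21 ∷ 28 ∷ []) ∷
  (4 ∷ 6 ∷ 8 ∷ 13 ∷ 14 ∷ 15 ∷ 18 ∷ 21 ∷ 22 ∷ 29 ∷ []) ∷
  (5 ∷ 7 ∷ 9 ∷ 14 ∷ 15 ∷ 16 ∷ 19 ∷ 22 ∷ 23 ∷ 30 ∷ []) ∷
  (0 ∷ 1 ∷ 2 ∷ 3 ∷ 4 ∷ 5 ∷ 6 ∷ 7 ∷ 8 ∷ 9 ∷ []) ∷
  (0 ∷ 1 ∷ 2 ∷ 10 ∷ 11 ∷ 12 ∷ 13 ∷ 14 ∷ 15 ∷ 16 ∷ []) ∷
  (0 ∷ 1 ∷ 2 ∷ 17 ∷ 18 ∷ 19 ∷ 20 ∷ 21 ∷ 22 ∷ 23 ∷ []) ∷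
  []

design-31 : IsDesign lines-31 points-31
design-31 = from-yes (isDesign? lines-31 points-31)

-- Invariant under x ↦ a σ(x) + b on F = 𝔽₈, with a ∈ F*, b ∈ F, σ ∈ Gal(F/𝔽₂),
-- acting on F* (points 0–6), on F (points 7–14) and on the ordered pairs of
-- distinct elements of F (points 15–70).
lines-71 : Table 71 15
lines-71 =
  (0 ∷ 1 ∷ 2 ∷ 3 ∷ 4 ∷ 5 ∷ 6 ∷ 7 ∷ 8 ∷ 9 ∷ 10 ∷ 11 ∷ 12 ∷ 13 ∷ 14 ∷ []) ∷
  (2 ∷ 4 ∷ 5 ∷ 17 ∷ 19 ∷ 20 ∷ 36 ∷ 40 ∷ 41 ∷ 50 ∷ 53 ∷ 55 ∷ 57 ∷ 60 ∷ 62 ∷ []) ∷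
  (1 ∷ 3 ∷ 5 ∷ 24 ∷ 26 ∷ 28 ∷ 37 ∷ 40 ∷ 42 ∷ 51 ∷ 53 ∷ 56 ∷ 65 ∷ 67 ∷ 69 ∷ []) ∷
  (2 ∷ 3 ∷ 6 ∷ 17 ∷ 18 ∷ 21 ∷ 36 ∷ 39 ∷ 42 ∷ 43 ∷ 46 ∷ 49 ∷ 64 ∷ 67 ∷ 68 ∷ []) ∷
  (2 ∷ 4 ∷ 5 ∷ 23 ∷ 25 ∷ 28 ∷ 30 ∷ 32 ∷ 35 ∷ 44 ∷ 45 ∷ 49 ∷ 65 ∷ 66 ∷ 68 ∷ []) ∷
  (0 ∷ 3 ∷ 4 ∷ 15 ∷ 18 ∷ 19 ∷ 22 ∷ 25 ∷ 26 ∷ 43 ∷ 44 ∷ 47 ∷ 50 ∷ 51 ∷ 54 ∷ []) ∷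
  (1 ∷ 3 ∷ 5 ∷ 16 ∷ 18 ∷ 20 ∷ 29 ∷ 32 ∷ 34 ∷ 43 ∷ 45 ∷ 48 ∷ 57 ∷ 59 ∷ 61 ∷ []) ∷
  (0 ∷ 5 ∷ 6 ∷ 15 ∷ 20 ∷ 21 ∷ 22 ∷ 27 ∷ 28 ∷ 57 ∷ 58 ∷ 63 ∷ 64 ∷ 65 ∷ 70 ∷ []) ∷
  (1 ∷ 4 ∷ 6 ∷ 16 ∷ 19 ∷ 21 ∷ 29 ∷ 33 ∷ 35 ∷ 50 ∷ 52 ∷ 56 ∷ 64 ∷ 66 ∷ 69 ∷ []) ∷
  (0 ∷ 3 ∷ 4 ∷ 31 ∷ 34 ∷ 35 ∷ 38 ∷ 41 ∷ 42 ∷ 59 ∷ 60 ∷ 63 ∷ 66 ∷ 67 ∷ 70 ∷ []) ∷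
  (2 ∷ 3 ∷ 6 ∷ 23 ∷ 26 ∷ 27 ∷ 30 ∷ 33 ∷ 34 ∷ 51 ∷ 52 ∷ 55 ∷ 58 ∷ 59 ∷ 62 ∷ []) ∷
  (1 ∷ 4 ∷ 6 ∷ 24 ∷ 25 ∷ 27 ∷ 37 ∷ 39 ∷ 41 ∷ 44 ∷ 46 ∷ 48 ∷ 58 ∷ 60 ∷ 61 ∷ []) ∷
  (0 ∷ 1 ∷ 2 ∷ 47 ∷ 48 ∷ 49 ∷ 54 ∷ 55 ∷ 56 ∷ 61 ∷ 62 ∷ 63 ∷ 68 ∷ 69 ∷ 70 ∷ []) ∷
  (0 ∷ 1 ∷ 2 ∷ 15 ∷ 16 ∷ 17 ∷ 22 ∷ 23 ∷ 24 ∷ 29 ∷ 30 ∷ 31 ∷ 36 ∷ 37 ∷ 38 ∷ []) ∷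
  (0 ∷ 5 ∷ 6 ∷ 31 ∷ 32 ∷ 33 ∷ 38 ∷ 39 ∷ 40 ∷ 45 ∷ 46 ∷ 47 ∷ 52 ∷ 53 ∷ 54 ∷ []) ∷
  (5 ∷ 10 ∷ 12 ∷ 16 ∷ 22 ∷ 26 ∷ 35 ∷ 37 ∷ 39 ∷ 41 ∷ 47 ∷ 49 ∷ 59 ∷ 62 ∷ 64 ∷ []) ∷
  (4 ∷ 7 ∷ 12 ∷ 24 ∷ 30 ∷ 38 ∷ 43 ∷ 46 ∷ 54 ∷ 55 ∷ 56 ∷ 57 ∷ 59 ∷ 64 ∷ 65 ∷ []) ∷
  (4 ∷ 7 ∷ 12 ∷ 15 ∷ 16 ∷ 17 ∷ 26 ∷ 27 ∷ 32 ∷ 33 ∷ 40 ∷ 42 ∷ 48 ∷ 63 ∷ 68 ∷ []) ∷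
  (0 ∷ 11 ∷ 12 ∷ 19 ∷ 21 ∷ 28 ∷ 30 ∷ 33 ∷ 37 ∷ 43 ∷ 45 ∷ 48 ∷ 60 ∷ 62 ∷ 67 ∷ []) ∷
  (2 ∷ 7 ∷ 10 ∷ 15 ∷ 20 ∷ 21 ∷ 24 ∷ 25 ∷ 32 ∷ 47 ∷ 52 ∷ 59 ∷ 60 ∷ 67 ∷ 69 ∷ []) ∷
  (3 ∷ 7 ∷ 11 ∷ 22 ∷ 27 ∷ 29 ∷ 31 ∷ 40 ∷ 44 ∷ 45 ∷ 49 ∷ 55 ∷ 60 ∷ 64 ∷ 69 ∷ []) ∷
  (6 ∷ 8 ∷ 13 ∷ 17 ∷ 20 ∷ 22 ∷ 25 ∷ 26 ∷ 35 ∷ 38 ∷ 45 ∷ 48 ∷ 55 ∷ 56 ∷ 67 ∷ []) ∷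
  (2 ∷ 12 ∷ 13 ∷ 21 ∷ 22 ∷ 29 ∷ 34 ∷ 41 ∷ 42 ∷ 44 ∷ 48 ∷ 52 ∷ 53 ∷ 54 ∷ 65 ∷ []) ∷
  (3 ∷ 8 ∷ 12 ∷ 17 ∷ 23 ∷ 25 ∷ 28 ∷ 29 ∷ 33 ∷ 41 ∷ 46 ∷ 47 ∷ 57 ∷ 69 ∷ 70 ∷ []) ∷
  (6 ∷ 8 ∷ 13 ∷ 18 ∷ 29 ∷ 30 ∷ 37 ∷ 40 ∷ 47 ∷ 50 ∷ 59 ∷ 60 ∷ 63 ∷ 65 ∷ 68 ∷ []) ∷
  (4 ∷ 9 ∷ 14 ∷ 17 ∷ 22 ∷ 37 ∷ 43 ∷ 45 ∷ 52 ∷ 53 ∷ 58 ∷ 59 ∷ 68 ∷ 69 ∷ 70 ∷ []) ∷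
  (2 ∷ 7 ∷ 10 ∷ 28 ∷ 29 ∷ 35 ∷ 38 ∷ 39 ∷ 40 ∷ 43 ∷ 48 ∷ 50 ∷ 51 ∷ 58 ∷ 70 ∷ []) ∷
  (0 ∷ 7 ∷ 8 ∷ 24 ∷ 26 ∷ 28 ∷ 34 ∷ 36 ∷ 41 ∷ 45 ∷ 50 ∷ 52 ∷ 61 ∷ 64 ∷ 68 ∷ []) ∷
  (4 ∷ 8 ∷ 11 ∷ 18 ∷ 21 ∷ 22 ∷ 23 ∷ 24 ∷ 32 ∷ 34 ∷ 39 ∷ 40 ∷ 56 ∷ 62 ∷ 70 ∷ []) ∷
  (1 ∷ 11 ∷ 13 ∷ 17 ∷ 25 ∷ 28 ∷ 31 ∷ 32 ∷ 42 ∷ 50 ∷ 54 ∷ 58 ∷ 59 ∷ 62 ∷ 64 ∷ []) ∷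
  (4 ∷ 8 ∷ 11 ∷ 16 ∷ 31 ∷ 36 ∷ 47 ∷ 48 ∷ 49 ∷ 51 ∷ 52 ∷ 57 ∷ 58 ∷ 65 ∷ 67 ∷ []) ∷
  (2 ∷ 8 ∷ 9 ∷ 16 ∷ 19 ∷ 22 ∷ 27 ∷ 28 ∷ 40 ∷ 46 ∷ 54 ∷ 59 ∷ 61 ∷ 66 ∷ 67 ∷ []) ∷
  (3 ∷ 8 ∷ 12 ∷ 15 ∷ 21 ∷ 32 ∷ 37 ∷ 38 ∷ 49 ∷ 50 ∷ 53 ∷ 55 ∷ 58 ∷ 61 ∷ 66 ∷ []) ∷
  (4 ∷ 9 ∷ 14 ∷ 20 ∷ 21 ∷ 26 ∷ 28 ∷ 29 ∷ 30 ∷ 31 ∷ 39 ∷ 42 ∷ 47 ∷ 55 ∷ 61 ∷ []) ∷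
  (5 ∷ 8 ∷ 14 ∷ 19 ∷ 24 ∷ 25 ∷ 27 ∷ 29 ∷ 38 ∷ 42 ∷ 43 ∷ 49 ∷ 52 ∷ 62 ∷ 63 ∷ []) ∷
  (2 ∷ 11 ∷ 14 ∷ 15 ∷ 27 ∷ 34 ∷ 35 ∷ 37 ∷ 42 ∷ 45 ∷ 46 ∷ 47 ∷ 50 ∷ 56 ∷ 57 ∷ []) ∷
  (0 ∷ 9 ∷ 10 ∷ 17 ∷ 19 ∷ 26 ∷ 29 ∷ 32 ∷ 34 ∷ 46 ∷ 49 ∷ 56 ∷ 58 ∷ 60 ∷ 65 ∷ []) ∷
  (6 ∷ 7 ∷ 14 ∷ 26 ∷ 29 ∷ 32 ∷ 36 ∷ 37 ∷ 44 ∷ 54 ∷ 57 ∷ 62 ∷ 66 ∷ 67 ∷ 70 ∷ []) ∷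
  (3 ∷ 9 ∷ 13 ∷ 15 ∷ 16 ∷ 28 ∷ 38 ∷ 39 ∷ 44 ∷ 52 ∷ 56 ∷ 57 ∷ 60 ∷ 62 ∷ 68 ∷ []) ∷
  (3 ∷ 10 ∷ 14 ∷ 20 ∷ 22 ∷ 24 ∷ 31 ∷ 33 ∷ 46 ∷ 48 ∷ 50 ∷ 62 ∷ 65 ∷ 66 ∷ 68 ∷ []) ∷
  (2 ∷ 11 ∷ 14 ∷ 16 ∷ 18 ∷ 25 ∷ 26 ∷ 33 ∷ 38 ∷ 53 ∷ 60 ∷ 61 ∷ 64 ∷ 65 ∷ 70 ∷ []) ∷
  (1 ∷ 12 ∷ 14 ∷ 18 ∷ 22 ∷ 28 ∷ 32 ∷ 35 ∷ 36 ∷ 46 ∷ 51 ∷ 52 ∷ 55 ∷ 60 ∷ 63 ∷ []) ∷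
  (4 ∷ 10 ∷ 13 ∷ 15 ∷ 23 ∷ 29 ∷ 45 ∷ 46 ∷ 51 ∷ 53 ∷ 61 ∷ 62 ∷ 63 ∷ 64 ∷ 67 ∷ []) ∷
  (0 ∷ 13 ∷ 14 ∷ 16 ∷ 23 ∷ 27 ∷ 32 ∷ 39 ∷ 41 ∷ 43 ∷ 50 ∷ 55 ∷ 65 ∷ 67 ∷ 69 ∷ []) ∷
  (5 ∷ 7 ∷ 13 ∷ 16 ∷ 19 ∷ 21 ∷ 25 ∷ 31 ∷ 34 ∷ 37 ∷ 46 ∷ 51 ∷ 55 ∷ 68 ∷ 70 ∷ []) ∷
  (4 ∷ 10 ∷ 13 ∷ 18 ∷ 20 ∷ 27 ∷ 28 ∷ 33 ∷ 34 ∷ 36 ∷ 37 ∷ 38 ∷ 49 ∷ 54 ∷ 69 ∷ []) ∷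
  (5 ∷ 9 ∷ 11 ∷ 21 ∷ 23 ∷ 26 ∷ 36 ∷ 38 ∷ 44 ∷ 46 ∷ 48 ∷ 50 ∷ 59 ∷ 63 ∷ 69 ∷ []) ∷
  (1 ∷ 7 ∷ 9 ∷ 17 ∷ 18 ∷ 21 ∷ 27 ∷ 38 ∷ 41 ∷ 45 ∷ 47 ∷ 51 ∷ 62 ∷ 65 ∷ 66 ∷ []) ∷
  (0 ∷ 13 ∷ 14 ∷ 17 ∷ 21 ∷ 24 ∷ 33 ∷ 35 ∷ 40 ∷ 44 ∷ 49 ∷ 51 ∷ 57 ∷ 59 ∷ 61 ∷ []) ∷
  (3 ∷ 9 ∷ 13 ∷ 19 ∷ 24 ∷ 27 ∷ 30 ∷ 32 ∷ 35 ∷ 36 ∷ 47 ∷ 48 ∷ 53 ∷ 64 ∷ 70 ∷ []) ∷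
  (1 ∷ 8 ∷ 10 ∷ 21 ∷ 23 ∷ 26 ∷ 27 ∷ 31 ∷ 35 ∷ 43 ∷ 53 ∷ 54 ∷ 57 ∷ 60 ∷ 68 ∷ []) ∷
  (2 ∷ 8 ∷ 9 ∷ 20 ∷ 31 ∷ 32 ∷ 33 ∷ 37 ∷ 41 ∷ 43 ∷ 44 ∷ 51 ∷ 56 ∷ 63 ∷ 64 ∷ []) ∷
  (1 ∷ 8 ∷ 10 ∷ 15 ∷ 19 ∷ 33 ∷ 36 ∷ 39 ∷ 42 ∷ 44 ∷ 45 ∷ 55 ∷ 59 ∷ 65 ∷ 70 ∷ []) ∷
  (1 ∷ 11 ∷ 13 ∷ 15 ∷ 20 ∷ 26 ∷ 30 ∷ 40 ∷ 41 ∷ 43 ∷ 46 ∷ 49 ∷ 52 ∷ 66 ∷ 70 ∷ []) ∷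
  (0 ∷ 9 ∷ 10 ∷ 18 ∷ 23 ∷ 25 ∷ 37 ∷ 40 ∷ 42 ∷ 48 ∷ 52 ∷ 55 ∷ 57 ∷ 64 ∷ 66 ∷ []) ∷
  (0 ∷ 11 ∷ 12 ∷ 20 ∷ 25 ∷ 27 ∷ 29 ∷ 36 ∷ 39 ∷ 51 ∷ 53 ∷ 56 ∷ 59 ∷ 66 ∷ 68 ∷ []) ∷
  (6 ∷ 7 ∷ 14 ∷ 15 ∷ 18 ∷ 19 ∷ 23 ∷ 28 ∷ 31 ∷ 41 ∷ 48 ∷ 49 ∷ 53 ∷ 56 ∷ 59 ∷ []) ∷
  (5 ∷ 7 ∷ 13 ∷ 22 ∷ 23 ∷ 33 ∷ 36 ∷ 42 ∷ 43 ∷ 47 ∷ 56 ∷ 58 ∷ 60 ∷ 61 ∷ 66 ∷ []) ∷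
  (0 ∷ 7 ∷ 8 ∷ 16 ∷ 18 ∷ 20 ∷ 30 ∷ 35 ∷ 42 ∷ 44 ∷ 46 ∷ 53 ∷ 58 ∷ 62 ∷ 69 ∷ []) ∷
  (2 ∷ 12 ∷ 13 ∷ 18 ∷ 19 ∷ 24 ∷ 26 ∷ 31 ∷ 39 ∷ 45 ∷ 57 ∷ 58 ∷ 63 ∷ 66 ∷ 69 ∷ []) ∷
  (1 ∷ 7 ∷ 9 ∷ 22 ∷ 25 ∷ 30 ∷ 33 ∷ 34 ∷ 39 ∷ 49 ∷ 50 ∷ 53 ∷ 57 ∷ 63 ∷ 67 ∷ []) ∷
  (5 ∷ 8 ∷ 14 ∷ 15 ∷ 17 ∷ 30 ∷ 34 ∷ 39 ∷ 48 ∷ 51 ∷ 54 ∷ 60 ∷ 64 ∷ 66 ∷ 69 ∷ []) ∷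
  (3 ∷ 10 ∷ 14 ∷ 16 ∷ 21 ∷ 25 ∷ 30 ∷ 36 ∷ 40 ∷ 41 ∷ 45 ∷ 54 ∷ 56 ∷ 58 ∷ 63 ∷ []) ∷
  (5 ∷ 9 ∷ 11 ∷ 15 ∷ 18 ∷ 24 ∷ 29 ∷ 33 ∷ 35 ∷ 41 ∷ 54 ∷ 55 ∷ 58 ∷ 67 ∷ 68 ∷ []) ∷
  (6 ∷ 10 ∷ 11 ∷ 16 ∷ 17 ∷ 24 ∷ 28 ∷ 34 ∷ 43 ∷ 44 ∷ 47 ∷ 53 ∷ 55 ∷ 63 ∷ 66 ∷ []) ∷
  (3 ∷ 7 ∷ 11 ∷ 17 ∷ 19 ∷ 20 ∷ 23 ∷ 35 ∷ 37 ∷ 39 ∷ 52 ∷ 54 ∷ 61 ∷ 63 ∷ 65 ∷ []) ∷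
  (5 ∷ 10 ∷ 12 ∷ 17 ∷ 18 ∷ 27 ∷ 30 ∷ 31 ∷ 44 ∷ 50 ∷ 52 ∷ 56 ∷ 61 ∷ 67 ∷ 70 ∷ []) ∷
  (1 ∷ 12 ∷ 14 ∷ 19 ∷ 20 ∷ 23 ∷ 34 ∷ 38 ∷ 40 ∷ 44 ∷ 47 ∷ 58 ∷ 64 ∷ 67 ∷ 68 ∷ []) ∷
  (6 ∷ 9 ∷ 12 ∷ 15 ∷ 25 ∷ 31 ∷ 34 ∷ 35 ∷ 36 ∷ 40 ∷ 43 ∷ 61 ∷ 62 ∷ 65 ∷ 69 ∷ []) ∷
  (6 ∷ 10 ∷ 11 ∷ 19 ∷ 22 ∷ 30 ∷ 32 ∷ 38 ∷ 41 ∷ 42 ∷ 51 ∷ 57 ∷ 61 ∷ 68 ∷ 69 ∷ []) ∷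
  (6 ∷ 9 ∷ 12 ∷ 16 ∷ 20 ∷ 23 ∷ 24 ∷ 42 ∷ 45 ∷ 49 ∷ 50 ∷ 51 ∷ 54 ∷ 60 ∷ 70 ∷ []) ∷
  []

points-71 : Table 71 15
points-71 =
  (0 ∷ 5 ∷ 7 ∷ 9 ∷ 12 ∷ 13 ∷ 14 ∷ 18 ∷ 27 ∷ 36 ∷ 43 ∷ 48 ∷ 54 ∷ 55 ∷ 58 ∷ []) ∷
  (0 ∷ 2 ∷ 6 ∷ 8 ∷ 11 ∷ 12 ∷ 13 ∷ 29 ∷ 41 ∷ 47 ∷ 50 ∷ 52 ∷ 53 ∷ 60 ∷ 67 ∷ []) ∷
  (0 ∷ 1 ∷ 3 ∷ 4 ∷ 10 ∷ 12 ∷ 13 ∷ 19 ∷ 22 ∷ 26 ∷ 31 ∷ 35 ∷ 40 ∷ 51 ∷ 59 ∷ []) ∷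
  (0 ∷ 2 ∷ 3 ∷ 5 ∷ 6 ∷ 9 ∷ 10 ∷ 20 ∷ 23 ∷ 32 ∷ 38 ∷ 39 ∷ 49 ∷ 62 ∷ 65 ∷ []) ∷
  (0 ∷ 1 ∷ 4 ∷ 5 ∷ 8 ∷ 9 ∷ 11 ∷ 16 ∷ 17 ∷ 25 ∷ 28 ∷ 30 ∷ 33 ∷ 42 ∷ 45 ∷ []) ∷
  (0 ∷ 1 ∷ 2 ∷ 4 ∷ 6 ∷ 7 ∷ 14 ∷ 15 ∷ 34 ∷ 44 ∷ 46 ∷ 57 ∷ 61 ∷ 63 ∷ 66 ∷ []) ∷
  (0 ∷ 3 ∷ 7 ∷ 8 ∷ 10 ∷ 11 ∷ 14 ∷ 21 ∷ 24 ∷ 37 ∷ 56 ∷ 64 ∷ 68 ∷ 69 ∷ 70 ∷ []) ∷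
  (0 ∷ 16 ∷ 17 ∷ 19 ∷ 20 ∷ 26 ∷ 27 ∷ 37 ∷ 44 ∷ 47 ∷ 56 ∷ 57 ∷ 58 ∷ 60 ∷ 65 ∷ []) ∷
  (0 ∷ 21 ∷ 23 ∷ 24 ∷ 27 ∷ 28 ∷ 30 ∷ 31 ∷ 32 ∷ 34 ∷ 50 ∷ 51 ∷ 52 ∷ 58 ∷ 61 ∷ []) ∷
  (0 ∷ 25 ∷ 31 ∷ 33 ∷ 36 ∷ 38 ∷ 46 ∷ 47 ∷ 49 ∷ 51 ∷ 54 ∷ 60 ∷ 63 ∷ 68 ∷ 70 ∷ []) ∷
  (0 ∷ 15 ∷ 19 ∷ 26 ∷ 36 ∷ 39 ∷ 42 ∷ 45 ∷ 50 ∷ 52 ∷ 54 ∷ 62 ∷ 64 ∷ 66 ∷ 69 ∷ []) ∷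
  (0 ∷ 18 ∷ 20 ∷ 28 ∷ 29 ∷ 30 ∷ 35 ∷ 40 ∷ 46 ∷ 53 ∷ 55 ∷ 63 ∷ 64 ∷ 65 ∷ 69 ∷ []) ∷
  (0 ∷ 15 ∷ 16 ∷ 17 ∷ 18 ∷ 22 ∷ 23 ∷ 32 ∷ 41 ∷ 55 ∷ 59 ∷ 66 ∷ 67 ∷ 68 ∷ 70 ∷ []) ∷
  (0 ∷ 21 ∷ 22 ∷ 24 ∷ 29 ∷ 38 ∷ 42 ∷ 43 ∷ 44 ∷ 45 ∷ 48 ∷ 49 ∷ 53 ∷ 57 ∷ 59 ∷ []) ∷
  (0 ∷ 25 ∷ 33 ∷ 34 ∷ 35 ∷ 37 ∷ 39 ∷ 40 ∷ 41 ∷ 43 ∷ 48 ∷ 56 ∷ 61 ∷ 62 ∷ 67 ∷ []) ∷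
  (5 ∷ 7 ∷ 13 ∷ 17 ∷ 19 ∷ 32 ∷ 35 ∷ 38 ∷ 42 ∷ 52 ∷ 53 ∷ 56 ∷ 61 ∷ 63 ∷ 68 ∷ []) ∷
  (6 ∷ 8 ∷ 13 ∷ 15 ∷ 17 ∷ 30 ∷ 31 ∷ 38 ∷ 40 ∷ 43 ∷ 44 ∷ 58 ∷ 62 ∷ 64 ∷ 70 ∷ []) ∷
  (1 ∷ 3 ∷ 13 ∷ 17 ∷ 21 ∷ 23 ∷ 25 ∷ 29 ∷ 36 ∷ 47 ∷ 48 ∷ 61 ∷ 64 ∷ 65 ∷ 66 ∷ []) ∷
  (3 ∷ 5 ∷ 6 ∷ 24 ∷ 28 ∷ 40 ∷ 41 ∷ 45 ∷ 47 ∷ 54 ∷ 56 ∷ 58 ∷ 59 ∷ 63 ∷ 66 ∷ []) ∷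
  (1 ∷ 5 ∷ 8 ∷ 18 ∷ 31 ∷ 34 ∷ 36 ∷ 44 ∷ 49 ∷ 52 ∷ 56 ∷ 59 ∷ 65 ∷ 67 ∷ 69 ∷ []) ∷
  (1 ∷ 6 ∷ 7 ∷ 19 ∷ 21 ∷ 33 ∷ 39 ∷ 45 ∷ 51 ∷ 53 ∷ 55 ∷ 58 ∷ 65 ∷ 67 ∷ 70 ∷ []) ∷
  (3 ∷ 7 ∷ 8 ∷ 18 ∷ 19 ∷ 22 ∷ 28 ∷ 32 ∷ 33 ∷ 44 ∷ 46 ∷ 47 ∷ 48 ∷ 50 ∷ 62 ∷ []) ∷
  (5 ∷ 7 ∷ 13 ∷ 15 ∷ 20 ∷ 21 ∷ 22 ∷ 25 ∷ 28 ∷ 31 ∷ 39 ∷ 41 ∷ 57 ∷ 60 ∷ 69 ∷ []) ∷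
  (4 ∷ 10 ∷ 13 ∷ 23 ∷ 28 ∷ 42 ∷ 43 ∷ 46 ∷ 50 ∷ 54 ∷ 56 ∷ 57 ∷ 65 ∷ 67 ∷ 70 ∷ []) ∷
  (2 ∷ 11 ∷ 13 ∷ 16 ∷ 19 ∷ 27 ∷ 28 ∷ 34 ∷ 39 ∷ 48 ∷ 49 ∷ 59 ∷ 63 ∷ 64 ∷ 70 ∷ []) ∷
  (4 ∷ 5 ∷ 11 ∷ 19 ∷ 21 ∷ 23 ∷ 29 ∷ 34 ∷ 40 ∷ 44 ∷ 54 ∷ 55 ∷ 60 ∷ 62 ∷ 68 ∷ []) ∷
  (2 ∷ 5 ∷ 10 ∷ 15 ∷ 17 ∷ 21 ∷ 27 ∷ 33 ∷ 36 ∷ 37 ∷ 40 ∷ 46 ∷ 50 ∷ 53 ∷ 59 ∷ []) ∷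
  (7 ∷ 10 ∷ 11 ∷ 17 ∷ 20 ∷ 31 ∷ 34 ∷ 35 ∷ 43 ∷ 45 ∷ 47 ∷ 49 ∷ 50 ∷ 55 ∷ 66 ∷ []) ∷
  (2 ∷ 4 ∷ 7 ∷ 18 ∷ 23 ∷ 26 ∷ 27 ∷ 29 ∷ 31 ∷ 33 ∷ 38 ∷ 41 ∷ 45 ∷ 56 ∷ 64 ∷ []) ∷
  (6 ∷ 8 ∷ 13 ∷ 20 ∷ 22 ∷ 23 ∷ 24 ∷ 26 ∷ 33 ∷ 34 ∷ 36 ∷ 37 ∷ 42 ∷ 55 ∷ 63 ∷ []) ∷
  (4 ∷ 10 ∷ 13 ∷ 16 ∷ 18 ∷ 24 ∷ 33 ∷ 49 ∷ 53 ∷ 58 ∷ 60 ∷ 61 ∷ 62 ∷ 66 ∷ 69 ∷ []) ∷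
  (9 ∷ 13 ∷ 14 ∷ 20 ∷ 29 ∷ 30 ∷ 33 ∷ 39 ∷ 44 ∷ 50 ∷ 51 ∷ 56 ∷ 59 ∷ 66 ∷ 68 ∷ []) ∷
  (4 ∷ 6 ∷ 14 ∷ 17 ∷ 19 ∷ 28 ∷ 29 ∷ 32 ∷ 36 ∷ 37 ∷ 41 ∷ 43 ∷ 49 ∷ 51 ∷ 69 ∷ []) ∷
  (8 ∷ 10 ∷ 14 ∷ 17 ∷ 18 ∷ 23 ∷ 39 ∷ 40 ∷ 45 ∷ 48 ∷ 51 ∷ 52 ∷ 57 ∷ 60 ∷ 63 ∷ []) ∷
  (6 ∷ 9 ∷ 10 ∷ 22 ∷ 27 ∷ 28 ∷ 35 ∷ 36 ∷ 44 ∷ 45 ∷ 60 ∷ 61 ∷ 64 ∷ 67 ∷ 68 ∷ []) ∷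
  (4 ∷ 8 ∷ 9 ∷ 15 ∷ 21 ∷ 26 ∷ 35 ∷ 41 ∷ 48 ∷ 49 ∷ 50 ∷ 58 ∷ 63 ∷ 65 ∷ 68 ∷ []) ∷
  (1 ∷ 3 ∷ 13 ∷ 27 ∷ 30 ∷ 37 ∷ 41 ∷ 45 ∷ 46 ∷ 49 ∷ 52 ∷ 55 ∷ 57 ∷ 62 ∷ 68 ∷ []) ∷
  (2 ∷ 11 ∷ 13 ∷ 15 ∷ 18 ∷ 24 ∷ 25 ∷ 32 ∷ 35 ∷ 37 ∷ 44 ∷ 45 ∷ 51 ∷ 54 ∷ 65 ∷ []) ∷
  (9 ∷ 13 ∷ 14 ∷ 16 ∷ 21 ∷ 26 ∷ 32 ∷ 34 ∷ 38 ∷ 40 ∷ 45 ∷ 46 ∷ 47 ∷ 67 ∷ 69 ∷ []) ∷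
  (3 ∷ 11 ∷ 14 ∷ 15 ∷ 26 ∷ 28 ∷ 33 ∷ 38 ∷ 43 ∷ 52 ∷ 55 ∷ 59 ∷ 60 ∷ 61 ∷ 65 ∷ []) ∷
  (1 ∷ 2 ∷ 14 ∷ 17 ∷ 20 ∷ 24 ∷ 26 ∷ 28 ∷ 31 ∷ 48 ∷ 53 ∷ 54 ∷ 62 ∷ 67 ∷ 68 ∷ []) ∷
  (1 ∷ 9 ∷ 11 ∷ 15 ∷ 22 ∷ 23 ∷ 27 ∷ 43 ∷ 47 ∷ 51 ∷ 53 ∷ 56 ∷ 62 ∷ 63 ∷ 69 ∷ []) ∷
  (2 ∷ 3 ∷ 9 ∷ 17 ∷ 22 ∷ 29 ∷ 33 ∷ 34 ∷ 35 ∷ 52 ∷ 54 ∷ 57 ∷ 58 ∷ 69 ∷ 70 ∷ []) ∷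
  (3 ∷ 5 ∷ 6 ∷ 16 ∷ 18 ∷ 25 ∷ 26 ∷ 34 ∷ 43 ∷ 50 ∷ 51 ∷ 53 ∷ 57 ∷ 64 ∷ 68 ∷ []) ∷
  (4 ∷ 5 ∷ 11 ∷ 20 ∷ 22 ∷ 37 ∷ 38 ∷ 46 ∷ 48 ∷ 51 ∷ 52 ∷ 58 ∷ 64 ∷ 66 ∷ 67 ∷ []) ∷
  (4 ∷ 6 ∷ 14 ∷ 18 ∷ 20 ∷ 21 ∷ 25 ∷ 27 ∷ 35 ∷ 42 ∷ 47 ∷ 52 ∷ 59 ∷ 62 ∷ 70 ∷ []) ∷
  (3 ∷ 11 ∷ 14 ∷ 16 ∷ 23 ∷ 31 ∷ 35 ∷ 36 ∷ 39 ∷ 41 ∷ 42 ∷ 44 ∷ 46 ∷ 53 ∷ 58 ∷ []) ∷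
  (5 ∷ 12 ∷ 14 ∷ 15 ∷ 19 ∷ 23 ∷ 24 ∷ 30 ∷ 33 ∷ 35 ∷ 47 ∷ 49 ∷ 57 ∷ 64 ∷ 67 ∷ []) ∷
  (6 ∷ 11 ∷ 12 ∷ 17 ∷ 18 ∷ 21 ∷ 22 ∷ 26 ∷ 30 ∷ 39 ∷ 46 ∷ 49 ∷ 54 ∷ 56 ∷ 61 ∷ []) ∷
  (3 ∷ 4 ∷ 12 ∷ 15 ∷ 20 ∷ 30 ∷ 32 ∷ 34 ∷ 36 ∷ 45 ∷ 48 ∷ 53 ∷ 56 ∷ 60 ∷ 70 ∷ []) ∷
  (1 ∷ 5 ∷ 8 ∷ 24 ∷ 26 ∷ 27 ∷ 29 ∷ 32 ∷ 35 ∷ 39 ∷ 43 ∷ 46 ∷ 60 ∷ 66 ∷ 70 ∷ []) ∷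
  (2 ∷ 5 ∷ 10 ∷ 26 ∷ 30 ∷ 41 ∷ 42 ∷ 44 ∷ 47 ∷ 48 ∷ 51 ∷ 55 ∷ 61 ∷ 69 ∷ 70 ∷ []) ∷
  (8 ∷ 10 ∷ 14 ∷ 19 ∷ 22 ∷ 25 ∷ 27 ∷ 30 ∷ 34 ∷ 38 ∷ 41 ∷ 53 ∷ 54 ∷ 65 ∷ 66 ∷ []) ∷
  (1 ∷ 2 ∷ 14 ∷ 22 ∷ 25 ∷ 32 ∷ 40 ∷ 42 ∷ 49 ∷ 50 ∷ 55 ∷ 56 ∷ 58 ∷ 60 ∷ 64 ∷ []) ∷
  (5 ∷ 12 ∷ 14 ∷ 16 ∷ 22 ∷ 29 ∷ 31 ∷ 37 ∷ 45 ∷ 50 ∷ 61 ∷ 62 ∷ 63 ∷ 65 ∷ 70 ∷ []) ∷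
  (1 ∷ 10 ∷ 12 ∷ 16 ∷ 20 ∷ 21 ∷ 32 ∷ 33 ∷ 41 ∷ 43 ∷ 44 ∷ 52 ∷ 54 ∷ 63 ∷ 64 ∷ []) ∷
  (2 ∷ 8 ∷ 12 ∷ 16 ∷ 21 ∷ 28 ∷ 35 ∷ 36 ∷ 38 ∷ 51 ∷ 55 ∷ 56 ∷ 57 ∷ 62 ∷ 66 ∷ []) ∷
  (1 ∷ 6 ∷ 7 ∷ 16 ∷ 23 ∷ 30 ∷ 35 ∷ 37 ∷ 38 ∷ 48 ∷ 50 ∷ 54 ∷ 59 ∷ 60 ∷ 69 ∷ []) ∷
  (7 ∷ 10 ∷ 11 ∷ 25 ∷ 26 ∷ 29 ∷ 30 ∷ 32 ∷ 36 ∷ 57 ∷ 58 ∷ 59 ∷ 62 ∷ 63 ∷ 67 ∷ []) ∷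
  (6 ∷ 9 ∷ 10 ∷ 15 ∷ 16 ∷ 19 ∷ 24 ∷ 25 ∷ 29 ∷ 31 ∷ 46 ∷ 48 ∷ 52 ∷ 55 ∷ 56 ∷ []) ∷
  (1 ∷ 9 ∷ 11 ∷ 18 ∷ 19 ∷ 20 ∷ 24 ∷ 36 ∷ 38 ∷ 40 ∷ 41 ∷ 50 ∷ 57 ∷ 61 ∷ 70 ∷ []) ∷
  (6 ∷ 11 ∷ 12 ∷ 27 ∷ 31 ∷ 32 ∷ 33 ∷ 40 ∷ 42 ∷ 48 ∷ 57 ∷ 65 ∷ 66 ∷ 68 ∷ 69 ∷ []) ∷
  (1 ∷ 10 ∷ 12 ∷ 15 ∷ 18 ∷ 28 ∷ 29 ∷ 34 ∷ 37 ∷ 38 ∷ 39 ∷ 42 ∷ 47 ∷ 58 ∷ 68 ∷ []) ∷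
  (7 ∷ 9 ∷ 12 ∷ 17 ∷ 24 ∷ 34 ∷ 41 ∷ 42 ∷ 46 ∷ 51 ∷ 59 ∷ 60 ∷ 62 ∷ 64 ∷ 65 ∷ []) ∷
  (3 ∷ 7 ∷ 8 ∷ 15 ∷ 16 ∷ 20 ∷ 27 ∷ 29 ∷ 40 ∷ 42 ∷ 49 ∷ 51 ∷ 54 ∷ 61 ∷ 67 ∷ []) ∷
  (2 ∷ 4 ∷ 7 ∷ 16 ∷ 22 ∷ 24 ∷ 30 ∷ 36 ∷ 39 ∷ 40 ∷ 43 ∷ 47 ∷ 52 ∷ 65 ∷ 68 ∷ []) ∷
  (4 ∷ 8 ∷ 9 ∷ 31 ∷ 32 ∷ 37 ∷ 39 ∷ 47 ∷ 53 ∷ 54 ∷ 55 ∷ 57 ∷ 59 ∷ 61 ∷ 64 ∷ []) ∷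
  (2 ∷ 3 ∷ 9 ∷ 18 ∷ 19 ∷ 21 ∷ 30 ∷ 31 ∷ 37 ∷ 42 ∷ 43 ∷ 60 ∷ 63 ∷ 66 ∷ 67 ∷ []) ∷
  (3 ∷ 4 ∷ 12 ∷ 17 ∷ 24 ∷ 25 ∷ 27 ∷ 38 ∷ 39 ∷ 44 ∷ 50 ∷ 55 ∷ 63 ∷ 67 ∷ 69 ∷ []) ∷
  (2 ∷ 8 ∷ 12 ∷ 19 ∷ 20 ∷ 23 ∷ 25 ∷ 43 ∷ 45 ∷ 46 ∷ 58 ∷ 59 ∷ 61 ∷ 68 ∷ 69 ∷ []) ∷
  (7 ∷ 9 ∷ 12 ∷ 23 ∷ 25 ∷ 26 ∷ 28 ∷ 37 ∷ 40 ∷ 44 ∷ 49 ∷ 52 ∷ 53 ∷ 66 ∷ 70 ∷ []) ∷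
  []

design-71 : IsDesign lines-71 points-71
design-71 = from-yes (isDesign? lines-71 points-71)

theorem10 : ∀ (n : ℕ) → (n % 3 ≡ 0 ⊎ n % 3 ≡ 2) → 3 ≤ n → n ≤ 14 → n ≢ 12 →
    ∃[ N ] Σ[ G ∈ Graph (Fin N) ]
    (Regular G (suc n) × HasVertexConnectivity G (suc n) × Trigeodetic G × Block G × HasDiameter G 4)
theorem10 0 _ ()
theorem10 1 _ (s≤s ())
theorem10 2 _ (s≤s (s≤s ()))
theorem10 3 _ _ _ _ = DesignGraph.regular-block design-5 (s≤s z≤n)
theorem10 4 (inj₁ ())
theorem10 4 (inj₂ ())
theorem10 5 _ _ _ _ = DesignGraph.regular-block design-11 (s≤s z≤n)
theorem10 6 _ _ _ _ = DesignGraph.regular-block design-15 (s≤s z≤n)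
theorem10 7 (inj₁ ())
theorem10 7 (inj₂ ())
theorem10 8 _ _ _ _ = DesignGraph.regular-block design-25 (s≤s z≤n)
theorem10 9 _ _ _ _ = DesignGraph.regular-block design-31 (s≤s z≤n)
theorem10 10 (inj₁ ())
theorem10 10 (inj₂ ())
theorem10 11 _ _ _ _ = DesignGraph.regular-block design-45 (s≤s z≤n)
theorem10 12 _ _ _ n≢12 = contradiction refl n≢12
theorem10 13 (inj₁ ())
theorem10 13 (inj₂ ())
theorem10 14 _ _ _ _ = DesignGraph.regular-block design-71 (s≤s z≤n)
theorem10 (suc (suc (suc (suc (suc (suc (suc (suc (suc (suc (suc (suc (suc (suc (suc _))))))))))))))) _ _
  (s≤s (s≤s (s≤s (s≤s (s≤s (s≤s (s≤s (s≤s (s≤s (s≤s (s≤s (s≤s (s≤s (s≤s ()))))))))))))))
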